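{- Let $\ell\geq 2$ be an integer with $\ell\equiv 2 \pmod 3$ and let $p\geq 5$ be a prime. Then $\ell(3\ell-1)$ is not of the form $pm^2\pm m(p-2)$ for any positive integer $m$. Furthermore, there are infinitely many integers $n$ for which $\overline{C}_{p,1}(n)$ is an odd integer.
   Context: An overpartition of a positive integer $n$ is a non-increasing sequence of positive integers summing to $n$ in which the first occurrence of each distinct part may be overlined. For integers $k\geq 3$ and $1\leq i\leq \lfloor k/2\rfloor$, $\overline{C}_{k,i}(n)$ denotes the number of overpartitions of $n$ in which no part is divisible by $k$ and only parts congruent to $\pm i \pmod k$ may be overlined; equivalently $\sum_{n\geq 0}\overline{C}_{k,i}(n)q^n=\frac{(q^k;q^k)_\infty(-q^i;q^k)_\infty(-q^{k-i};q^k)_\infty}{(q;q)_\infty}$, where $(a;q)_\infty=\prod_{j\geq 0}(1-aq^j)$. In particular $\overline{C}_{k,i}(0)=1$. -}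

module Defs where

open import Data.Nat using (ℕ; zero; suc; _+_; _∸_; _%_; _≡ᵇ_; _≤ᵇ_)
open import Data.Bool using (Bool; true; false; _∧_; _∨_; not)
open import Data.Product using (_×_; _,_; proj₁)
open import Data.List using (List; []; _∷_; map; concatMap; length; filterᵇ; upTo; cartesianProduct; applyUpTo)

-- An entry of an overpartition: (part size, overlined?).
Entry : Set
Entry = ℕ × Bool

partSum : List Entry → ℕ
partSum []             = 0
partSum ((a , _) ∷ xs) = a + partSum xs

nonIncreasingᵇ : List Entry → Bool
nonIncreasingᵇ []                           = true
nonIncreasingᵇ (_ ∷ [])                     = true
nonIncreasingᵇ ((a , _) ∷ (b , o) ∷ xs)     = (b ≤ᵇ a) ∧ nonIncreasingᵇ ((b , o) ∷ xs)

firstOccOverlineᵇ : List Entry → Bool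
firstOccOverlineᵇ []                        = true
firstOccOverlineᵇ (_ ∷ [])                  = true
firstOccOverlineᵇ ((a , _) ∷ (b , o) ∷ xs)  =
  (not o ∨ not (a ≡ᵇ b)) ∧ firstOccOverlineᵇ ((b , o) ∷ xs)

entryOKᵇ : (k i : ℕ) → Entry → Bool
entryOKᵇ zero    i (a , o) = false   -- k = 0 never used (k ≥ 3 in the paper)
entryOKᵇ (suc k) i (a , o) =
  not (a ≡ᵇ 0) ∧ not ((a % suc k) ≡ᵇ 0)
  ∧ (not o ∨ ((a % suc k) ≡ᵇ i) ∨ ((a % suc k) ≡ᵇ (suc k ∸ i)))

allᵇ : {A : Set} → (A → Bool) → List A → Bool
allᵇ f []       = true
allᵇ f (x ∷ xs) = f x ∧ allᵇ f xs

isCkiOverpartitionᵇ : (k i n : ℕ) → List Entry → Bool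
isCkiOverpartitionᵇ k i n xs =
  (partSum xs ≡ᵇ n) ∧ nonIncreasingᵇ xs ∧ firstOccOverlineᵇ xs ∧ allᵇ (entryOKᵇ k i) xs

words : {A : Set} → List A → ℕ → List (List A)
words alph zero    = [] ∷ []
words alph (suc L) = concatMap (λ x → map (x ∷_) (words alph L)) alph

entries : ℕ → List Entry
entries n = cartesianProduct (applyUpTo suc n) (true ∷ false ∷ [])

-- all candidate lists: length 0..n, entries with parts in 1..n (each list exactly once).
-- Every overpartition of n has at most n parts, each in 1..n.
candidates : ℕ → List (List Entry)
candidates n = concatMap (words (entries n)) (upTo (suc n))

Cbar : (k i n : ℕ) → ℕ
Cbar k i n = length (filterᵇ (isCkiOverpartitionᵇ k i n) (candidates n))

{-# OPTIONS --safe #-}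
module Submission where

-- Modulo 2 a part ≡ ±1 contributes (1 + q^a) / (1 - q^a) ≡ 1, so the generating function G of the
-- counts is ∏ 1 / (1 - q^a) over the a ≢ 0, ±1 (mod p), and G (q;q)_∞ ≡ ∏_{a ≡ 0, ±1} (1 + q^a).
-- Jacobi's triple product turns the right side into a theta series with exponents
-- (p n² ± n (p - 2)) / 2, and its case p = 3 is the pentagonal number theorem for (q;q)_∞.
-- Compare coefficients at the pentagonal number N = ℓ (3ℓ - 1) / 2 with ℓ ≡ 2 (mod 3).  By the
-- congruence mod 3 the right side vanishes, while the left side contains the count at 0, which is 1.
-- Hence some other term is odd; it sits at a distance of at least ℓ - 1 from N, because the
-- gaps between pentagonal numbers grow.

open import Defs
open import Algebra.Properties.CommutativeSemigroup using (x∙yz≈y∙xz)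
open import Data.Bool using (Bool; true; false; _∧_; _∨_; _xor_; not; if_then_else_)
open import Data.Bool.Properties
  using ( ∧-comm; ∧-identityʳ; ∧-zeroʳ; ∧-distribˡ-xor; ∧-distribʳ-xor; ∨-zeroʳ; not-involutive; ¬-not
        ; xor-assoc; xor-comm; xor-identityʳ )
  renaming (_≟_ to _≟ᵇ_)
open import Data.Bool.Solver using (module xor-∧-Solver)
open import Data.Empty using (⊥-elim)
open import Data.List using (List; []; _∷_; _++_; map; concatMap; length; filterᵇ; upTo; applyUpTo; cartesianProduct)
open import Data.Nat using (ℕ; zero; suc; _+_; _*_; _∸_; _%_; _≤_; _<_; _≡ᵇ_; _≤ᵇ_; _<ᵇ_; z≤n; s≤s)
open import Data.Nat.Divisibility using (m%n≡0⇒n∣m)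
open import Data.Nat.DivMod
  using ([m+kn]%n≡m%n; m<n⇒m%n≡m; m%n<n; n%n≡0; m*n%n≡0; %-distribˡ-+; %-distribˡ-*)
open import Data.Nat.Primality using (Prime; prime⇒irreducible)
open import Data.Nat.Properties
  using ( +-comm; +-suc; +-identityʳ; *-suc; *-comm; *-zeroʳ; +-cancelʳ-≡; +-cancelˡ-≤
        ; +-cancelʳ-≤; +-mono-≤; +-monoˡ-≤; *-monoˡ-≤; *-monoʳ-≤; ≤-refl; ≤-reflexive; ≤-trans
        ; ≤-total; ≤-<-trans; <-≤-trans; <⇒≤; <⇒≢; <-cmp; <-≤-connex; <-irrefl
        ; n<1+n; n≤1+n; m<m+n; m≤m+n; m≤n+m; m≤m*n; m≤n*m; m≤n⇒m≤1+n
        ; m≤n⇒m<n∨m≡n; m≤n⇒m∸n≡0; m+n∸n≡m; m+[n∸m]≡n; m∸n≤m; m∸n+n≡m; m+n≤o⇒m≤o∸n; *-distribˡ-∸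
        ; *-commutativeSemigroup; _≤?_; anyUpTo?
        ; module ≤-Reasoning )
open import Data.Nat.Solver using (module +-*-Solver)
open import Data.Product using (_×_; _,_; Σ; proj₁; proj₂)
open import Data.Sum using (_⊎_; inj₁; inj₂)
open import Function using (_∘_; id)
open import Relation.Binary.Definitions using (tri<; tri≈; tri>)
open import Relation.Binary.PropositionalEquality
open import Relation.Nullary using (yes; no)
open import Relation.Nullary.Decidable using (_×-dec_)

-- Power series are never multiplied or inverted, and no infinite product is formed. Modulo 2 the
-- signs disappear, so a factor 1 - q^a is the operator `1+q^ a ·_`; finite products of such
-- operators act on an arbitrary series `f`, and identities hold below a stated power of q. The
-- freedom in `f` is essential: for `f` the unknown parity series, the pentagonal number theorem is
-- at once a recurrence for parities, while for `f = δ` the triple product expands the right side.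
-- The triple product is obtained from its finite form, a q-binomial theorem, so that passing to the
-- limit is only an estimate of precision. Theta series run over all integers; to stay within the
-- naturals, an index m with origin s stands for the integer m - s, and identities with negative
-- exponents are cleared by adding to both sides.

-- Power series modulo 2, shifts and factors 1 + q^a

Series : Set
Series = ℕ → Bool

infixl 6 _⊕_
infix 4 _≈[_]_

_⊕_ : Series → Series → Series
(f ⊕ g) n = f n xor g n

δ : Series
δ zero    = true
δ (suc _) = false

shift : ℕ → Series → Series
shift zero    f n       = f n
shift (suc a) f zero    = false
shift (suc a) f (suc n) = shift a f n

infixr 7 1+q^_·_

1+q^_·_ : ℕ → Series → Series
1+q^ a · f = f ⊕ shift a f

_≈[_]_ : Series → ℕ → Series → Set
f ≈[ K ] g = ∀ n → n < K → f n ≡ g n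

xor-interchange : ∀ a b c d → (a xor b) xor (c xor d) ≡ (a xor c) xor (b xor d)
xor-interchange = solve 4 (λ a b c d → (a :+ b) :+ (c :+ d) := (a :+ c) :+ (b :+ d)) refl
  where
  open xor-∧-Solver

xor-cancel : ∀ a b c → (a xor b) xor (b xor c) ≡ a xor c
xor-cancel = solve 3 (λ a b c → (a :+ b) :+ (b :+ c) := a :+ c) refl
  where
  open xor-∧-Solver

⊕-cong : ∀ {f f′ g g′} → f ≗ f′ → g ≗ g′ → f ⊕ g ≗ f′ ⊕ g′
⊕-cong p q n = cong₂ _xor_ (p n) (q n)

shift-cong : ∀ a {f g} → f ≗ g → shift a f ≗ shift a g
shift-cong zero    p n       = p n
shift-cong (suc a) p zero    = refl
shift-cong (suc a) p (suc n) = shift-cong a p n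

shift-⊕ : ∀ a f g → shift a (f ⊕ g) ≗ shift a f ⊕ shift a g
shift-⊕ zero    f g n       = refl
shift-⊕ (suc a) f g zero    = refl
shift-⊕ (suc a) f g (suc n) = shift-⊕ a f g n

shift-+ : ∀ a b f → shift a (shift b f) ≗ shift (a + b) f
shift-+ zero    b f n       = refl
shift-+ (suc a) b f zero    = refl
shift-+ (suc a) b f (suc n) = shift-+ a b f n

shift-≡ : ∀ {a b} f → a ≡ b → shift a f ≗ shift b f
shift-≡ f refl n = refl

shift-comm : ∀ a b f → shift a (shift b f) ≗ shift b (shift a f)
shift-comm a b f n =
  trans (shift-+ a b f n) (trans (shift-≡ f (+-comm a b) n) (sym (shift-+ b a f n)))

shift-below : ∀ a f n → n < a → shift a f n ≡ false
shift-below (suc a) f zero    _         = refl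
shift-below (suc a) f (suc n) (s≤s n<a) = shift-below a f n n<a

shift-above : ∀ a f n → shift a f (a + n) ≡ f n
shift-above zero    f n = refl
shift-above (suc a) f n = shift-above a f n

shift-≈ : ∀ a {K f g} → f ≈[ K ] g → shift a f ≈[ a + K ] shift a g
shift-≈ zero    p n       n<K       = p n n<K
shift-≈ (suc a) p zero    _         = refl
shift-≈ (suc a) p (suc n) (s≤s n<K) = shift-≈ a p n n<K

≗⇒≈ : ∀ {K f g} → f ≗ g → f ≈[ K ] g
≗⇒≈ p n _ = p n

≈-trans : ∀ {K f g h} → f ≈[ K ] g → g ≈[ K ] h → f ≈[ K ] h
≈-trans p q n l = trans (p n l) (q n l)

≈-weaken : ∀ {K K′ f g} → K ≤ K′ → f ≈[ K′ ] g → f ≈[ K ] g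
≈-weaken K≤K′ p n l = p n (<-≤-trans l K≤K′)

1+q-cong : ∀ a {f g} → f ≗ g → 1+q^ a · f ≗ 1+q^ a · g
1+q-cong a p = ⊕-cong p (shift-cong a p)

1+q-≈-cong : ∀ a {K f g} → f ≈[ K ] g → 1+q^ a · f ≈[ K ] 1+q^ a · g
1+q-≈-cong a {K} p n l =
  cong₂ _xor_ (p n l) (≈-weaken (m≤n+m K a) (shift-≈ a p) n l)

1+q-≈ : ∀ a f → 1+q^ a · f ≈[ a ] f
1+q-≈ a f n l = trans (cong (f n xor_) (shift-below a f n l)) (xor-identityʳ (f n))

1+q-⊕ : ∀ a f g → 1+q^ a · (f ⊕ g) ≗ (1+q^ a · f) ⊕ (1+q^ a · g)
1+q-⊕ a f g n = trans (cong ((f n xor g n) xor_) (shift-⊕ a f g n)) (xor-interchange (f n) _ _ _)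

1+q-shift : ∀ a b f → 1+q^ a · (shift b f) ≗ shift b (1+q^ a · f)
1+q-shift a b f n = trans (cong (shift b f n xor_) (shift-comm a b f n)) (sym (shift-⊕ b f _ n))

-- Finite products of factors 1 + q^a as operators

∏1+q : (ℕ → ℕ) → ℕ → Series → Series
∏1+q α zero    f = f
∏1+q α (suc n) f = 1+q^ α n · ∏1+q α n f

∏-cong : ∀ α n {f g} → f ≗ g → ∏1+q α n f ≗ ∏1+q α n g
∏-cong α zero    p = p
∏-cong α (suc n) p = 1+q-cong (α n) (∏-cong α n p)

∏-⊕ : ∀ α n f g → ∏1+q α n (f ⊕ g) ≗ ∏1+q α n f ⊕ ∏1+q α n g
∏-⊕ α zero    f g i = refl
∏-⊕ α (suc n) f g i = trans (1+q-cong (α n) (∏-⊕ α n f g) i) (1+q-⊕ (α n) (∏1+q α n f) (∏1+q α n g) i)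

∏-shift : ∀ α n b f → ∏1+q α n (shift b f) ≗ shift b (∏1+q α n f)
∏-shift α zero    b f i = refl
∏-shift α (suc n) b f i =
  trans (1+q-cong (α n) (∏-shift α n b f) i) (1+q-shift (α n) b _ i)

∏-1+q : ∀ α n b f → ∏1+q α n (1+q^ b · f) ≗ 1+q^ b · ∏1+q α n f
∏-1+q α n b f i = trans (∏-⊕ α n f _ i) (cong (∏1+q α n f i xor_) (∏-shift α n b f i))

-- Finite sums modulo 2 and sums along antidiagonals

∑ : (ℕ → Bool) → ℕ → Bool
∑ h zero    = false
∑ h (suc n) = ∑ h n xor h n

∑-cong : ∀ {g h} n → (∀ i → i < n → g i ≡ h i) → ∑ g n ≡ ∑ h n
∑-cong zero    p = refl
∑-cong (suc n) p = cong₂ _xor_ (∑-cong n (λ i l → p i (m≤n⇒m≤1+n l))) (p n ≤-refl)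

∑-front : ∀ h n → ∑ h (suc n) ≡ h 0 xor ∑ (λ i → h (suc i)) n
∑-front h zero    = sym (xor-identityʳ (h 0))
∑-front h (suc n) = trans (cong (_xor h (suc n)) (∑-front h n)) (xor-assoc (h 0) _ _)

-- Both indices are carried along to spare the subtraction M - i, and because the Gaussian binomials
-- summed below are symmetric in them.
antidiag : (ℕ → ℕ → Series) → ℕ → Series
antidiag h zero    = h 0 0
antidiag h (suc M) = h 0 (suc M) ⊕ antidiag (λ i j → h (suc i) j) M

antidiag-cong : ∀ {h h′} M → (∀ i j → i + j ≡ M → h i j ≗ h′ i j) → antidiag h M ≗ antidiag h′ M
antidiag-cong zero    p = p 0 0 refl
antidiag-cong (suc M) p =
  ⊕-cong (p 0 (suc M) refl) (antidiag-cong M (λ i j e → p (suc i) j (cong suc e)))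

antidiag-≈ : ∀ {h h′ K} M →
  (∀ i j → i + j ≡ M → h i j ≈[ K ] h′ i j) → antidiag h M ≈[ K ] antidiag h′ M
antidiag-≈ zero    p n l = p 0 0 refl n l
antidiag-≈ (suc M) p n l =
  cong₂ _xor_ (p 0 (suc M) refl n l) (antidiag-≈ M (λ i j e → p (suc i) j (cong suc e)) n l)

antidiag-shift : ∀ a h M → shift a (antidiag h M) ≗ antidiag (λ i j → shift a (h i j)) M
antidiag-shift a h zero    n = refl
antidiag-shift a h (suc M) n =
  trans (shift-⊕ a _ _ n) (cong (shift a (h 0 (suc M)) n xor_) (antidiag-shift a _ M n))

antidiag-∏ : ∀ α K h M → ∏1+q α K (antidiag h M) ≗ antidiag (λ i j → ∏1+q α K (h i j)) M
antidiag-∏ α K h zero    n = refl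
antidiag-∏ α K h (suc M) n =
  trans (∏-⊕ α K _ _ n) (cong (∏1+q α K (h 0 (suc M)) n xor_) (antidiag-∏ α K _ M n))

-- The boundary term w makes the statement stable under the shift i ↦ i + 1 of the induction.
antidiag-split : ∀ (h u v : ℕ → ℕ → Series) (w : ℕ → Series) M →
  (∀ j → h 0 (suc j) ≗ u 0 j ⊕ w j) →
  (∀ i → h (suc i) 0 ≗ v i 0) →
  (∀ i j → h (suc i) (suc j) ≗ u (suc i) j ⊕ v i (suc j)) →
  antidiag h (suc M) ≗ antidiag u M ⊕ antidiag v M ⊕ w M
antidiag-split h u v w zero hw hv huv n =
  trans (cong₂ _xor_ (hw 0 n) (hv 0 n)) (rearrange (u 0 0 n) (w 0 n) (v 0 0 n))
  where
  open xor-∧-Solver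
  rearrange : ∀ a b c → (a xor b) xor c ≡ (a xor c) xor b
  rearrange = solve 3 (λ a b c → (a :+ b) :+ c := (a :+ c) :+ b) refl
antidiag-split h u v w (suc M) hw hv huv n =
  trans (cong₂ _xor_ (hw (suc M) n)
          (antidiag-split (λ i → h (suc i)) (λ i → u (suc i)) (λ i → v (suc i))
            (λ j → v 0 (suc j)) M (huv 0) (λ i → hv (suc i)) (λ i → huv (suc i)) n))
        (rearrange (u 0 (suc M) n) (w (suc M) n) (antidiag (λ i → u (suc i)) M n)
                   (antidiag (λ i → v (suc i)) M n) (v 0 (suc M) n))
  where
  open xor-∧-Solver
  rearrange : ∀ a b c d e → (a xor b) xor ((c xor d) xor e) ≡ ((a xor c) xor (e xor d)) xor b
  rearrange = solve 5 (λ a b c d e → (a :+ b) :+ ((c :+ d) :+ e) := ((a :+ c) :+ (e :+ d)) :+ b) refl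

antidiag-split₀ : ∀ (h u v : ℕ → ℕ → Series) M →
  (∀ j → h 0 (suc j) ≗ u 0 j) →
  (∀ i → h (suc i) 0 ≗ v i 0) →
  (∀ i j → h (suc i) (suc j) ≗ u (suc i) j ⊕ v i (suc j)) →
  antidiag h (suc M) ≗ antidiag u M ⊕ antidiag v M
antidiag-split₀ h u v M hu hv huv n =
  trans (antidiag-split h u v (λ _ _ → false) M
           (λ j i → trans (hu j i) (sym (xor-identityʳ _))) hv huv n)
        (xor-identityʳ _)

antidiag-∑ : ∀ (h : ℕ → Series) M n → antidiag (λ i _ → h i) M n ≡ ∑ (λ i → h i n) (suc M)
antidiag-∑ h zero    n = refl
antidiag-∑ h (suc M) n =
  trans (cong (h 0 n xor_) (antidiag-∑ (λ i → h (suc i)) M n)) (sym (∑-front (λ i → h i n) (suc M)))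

-- Boolean tests and products over selected exponents

n≡ᵇn : ∀ n → (n ≡ᵇ n) ≡ true
n≡ᵇn zero    = refl
n≡ᵇn (suc n) = n≡ᵇn n

<⇒≢ᵇ : ∀ {m n} → m < n → (m ≡ᵇ n) ≡ false
<⇒≢ᵇ {zero}  (s≤s _) = refl
<⇒≢ᵇ {suc m} (s≤s l) = <⇒≢ᵇ l

-- The factor 1 + q^a is kept for those a ≤ M which satisfy c.
∏≤ : (ℕ → Bool) → ℕ → Series → Series
∏≤ c zero    f = f
∏≤ c (suc M) f = if c (suc M) then 1+q^ suc M · ∏≤ c M f else ∏≤ c M f

exceptional : (k i r : ℕ) → Bool
exceptional k i r = (r ≡ᵇ 0) ∨ (r ≡ᵇ i) ∨ (r ≡ᵇ k ∸ i)

-- Jacobi's triple product in base q^k with z = q: the exponents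

module Jacobi (d : ℕ) where

  k : ℕ
  k = 2 + d

  -- These are (k n² - n d) / 2 and (k n² + n d) / 2. Defining them by their increments avoids the
  -- halving, and the increments are exactly the exponents of the factors in the product.
  pos neg : ℕ → ℕ
  pos zero    = 0
  pos (suc n) = pos n + (k * n + 1)
  neg zero    = 0
  neg (suc n) = neg n + (k * n + suc d)

  -- The theta exponent at the integer m - s: `pos (m - s)` for m ≥ s and `neg (s - m)` otherwise.
  expo : ℕ → ℕ → ℕ
  expo zero    m       = pos m
  expo (suc s) zero    = neg (suc s)
  expo (suc s) (suc m) = expo s m

  expo-zero : ∀ s → expo s 0 ≡ neg s
  expo-zero zero    = refl
  expo-zero (suc s) = refl

  -- The increment at the integer m - s is k (m - s) + 1; the term `k * s` stands on the left
  -- because this may be negative.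
  expo-step : ∀ s m → expo s (suc m) + k * s ≡ expo s m + (k * m + 1)
  expo-step zero m =
    solve 3 (λ d a b → a :+ b :+ (con 2 :+ d) :* con 0 := a :+ b) refl d (pos m) (k * m + 1)
    where
    open +-*-Solver
  expo-step (suc s) zero = begin
    expo s 0 + k * suc s             ≡⟨ cong (_+ k * suc s) (expo-zero s) ⟩
    neg s + k * suc s                ≡⟨ solve 3 (λ d s a → a :+ (con 2 :+ d) :* (con 1 :+ s)
                                          := a :+ ((con 2 :+ d) :* s :+ (con 1 :+ d)) :+ ((con 2 :+ d) :* con 0 :+ con 1))
                                          refl d s (neg s) ⟩
    neg (suc s) + (k * 0 + 1)        ∎
    where
    open +-*-Solver
    open ≡-Reasoning
  expo-step (suc s) (suc m) = begin
    expo s (suc m) + k * suc s       ≡⟨ solve 3 (λ k s a → a :+ k :* (con 1 :+ s) := a :+ k :* s :+ k) refl k s _ ⟩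
    expo s (suc m) + k * s + k       ≡⟨ cong (_+ k) (expo-step s m) ⟩
    expo s m + (k * m + 1) + k       ≡⟨ solve 3 (λ k m a → a :+ (k :* m :+ con 1) :+ k := a :+ (k :* (con 1 :+ m) :+ con 1)) refl k m _ ⟩
    expo s m + (k * suc m + 1)       ∎
    where
    open +-*-Solver
    open ≡-Reasoning

  2*pos : ∀ n → 2 * pos n + n * d ≡ k * (n * n)
  2*pos zero    = sym (*-zeroʳ k)
  2*pos (suc n) = begin
    2 * (pos n + (k * n + 1)) + suc n * d
      ≡⟨ solve 3 (λ d n x → con 2 :* (x :+ ((con 2 :+ d) :* n :+ con 1)) :+ (con 1 :+ n) :* d
           := con 2 :* x :+ n :* d :+ (con 2 :+ d) :* (con 2 :* n :+ con 1)) refl d n (pos n) ⟩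
    2 * pos n + n * d + k * (2 * n + 1)
      ≡⟨ cong (_+ k * (2 * n + 1)) (2*pos n) ⟩
    k * (n * n) + k * (2 * n + 1)
      ≡⟨ solve 2 (λ k n → k :* (n :* n) :+ k :* (con 2 :* n :+ con 1) := k :* ((con 1 :+ n) :* (con 1 :+ n))) refl k n ⟩
    k * (suc n * suc n) ∎
    where
    open ≡-Reasoning
    open +-*-Solver

  neg≡pos+ : ∀ n → neg n ≡ pos n + n * d
  neg≡pos+ zero    = refl
  neg≡pos+ (suc n) = trans (cong (_+ (k * n + suc d)) (neg≡pos+ n))
    (solve 4 (λ d n x y → x :+ n :* d :+ (y :+ (con 1 :+ d)) := x :+ (y :+ con 1) :+ (con 1 :+ n) :* d)
       refl d n (pos n) (k * n))
    where
    open +-*-Solver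

  2*neg : ∀ n → 2 * neg n ≡ k * (n * n) + n * d
  2*neg n = begin
    2 * neg n                  ≡⟨ cong (2 *_) (neg≡pos+ n) ⟩
    2 * (pos n + n * d)        ≡⟨ solve 2 (λ x y → con 2 :* (x :+ y) := con 2 :* x :+ y :+ y) refl (pos n) (n * d) ⟩
    2 * pos n + n * d + n * d  ≡⟨ cong (_+ n * d) (2*pos n) ⟩
    k * (n * n) + n * d        ∎
    where
    open ≡-Reasoning
    open +-*-Solver

  2*pos-∸ : ∀ n → 2 * pos n ≡ k * (n * n) ∸ n * d
  2*pos-∸ n = trans (sym (m+n∸n≡m (2 * pos n) (n * d))) (cong (_∸ n * d) (2*pos n))

  pos-< : ∀ {m n} → m < n → pos m < pos n
  pos-< {m} {suc n} (s≤s m≤n) = ≤-<-trans (weak (m≤n⇒m<n∨m≡n m≤n))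
    (m<m+n (pos n) (≤-trans (s≤s z≤n) (m≤n+m 1 (k * n))))
    where
    weak : m < n ⊎ m ≡ n → pos m ≤ pos n
    weak (inj₁ l)    = <⇒≤ (pos-< l)
    weak (inj₂ refl) = ≤-refl

  pos-≤ : ∀ {m n} → m ≤ n → pos m ≤ pos n
  pos-≤ l with m≤n⇒m<n∨m≡n l
  ... | inj₁ l′   = <⇒≤ (pos-< l′)
  ... | inj₂ refl = ≤-refl

  neg-≤ : ∀ {m n} → m ≤ n → neg m ≤ neg n
  neg-≤ {m} {n} l = subst₂ _≤_ (sym (neg≡pos+ m)) (sym (neg≡pos+ n)) (+-mono-≤ (pos-≤ l) (*-monoˡ-≤ d l))

  -- Gaussian binomials modulo 2

  -- The Gaussian binomial of i + j over i in base q^k, applied to `f`. One q-Pascal rule is the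
  -- definition; `pascal` is the other.
  gauss : Series → ℕ → ℕ → Series
  gauss f zero    j       = f
  gauss f (suc i) zero    = f
  gauss f (suc i) (suc j) = gauss f (suc i) j ⊕ shift (k * suc j) (gauss f i (suc j))

  -- Expanding both summands by induction gives four terms. In the corner term the two exponents add
  -- up to k (i + j + 3) from either side, so the terms can be regrouped by the defining rule.
  pascal : ∀ f i j →
    gauss f (suc i) (suc j) ≗ gauss f i (suc j) ⊕ shift (k * suc i) (gauss f (suc i) j)
  pascal f zero zero n = refl
  pascal f zero (suc j) n = begin
    gauss f 1 (suc j) n xor shift (k * (2 + j)) f n
      ≡⟨ cong₂ _xor_ (pascal f 0 j n) (trans (shift-≡ f (exponents k j) n) (sym (shift-+ (k * 1) (k * suc j) f n))) ⟩
    (f n xor shift (k * 1) (gauss f 1 j) n) xor shift (k * 1) (shift (k * suc j) f) n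
      ≡⟨ xor-assoc (f n) _ _ ⟩
    f n xor (shift (k * 1) (gauss f 1 j) n xor shift (k * 1) (shift (k * suc j) f) n)
      ≡⟨ cong (f n xor_) (shift-⊕ (k * 1) (gauss f 1 j) _ n) ⟨
    f n xor shift (k * 1) (gauss f 1 (suc j)) n ∎
    where
    open ≡-Reasoning
    exponents : ∀ k j → k * (2 + j) ≡ k * 1 + k * suc j
    exponents = solve 2 (λ k j → k :* (con 2 :+ j) := k :* con 1 :+ k :* (con 1 :+ j)) refl
      where
      open +-*-Solver
  pascal f (suc i) zero n = begin
    f n xor shift (k * 1) (gauss f (suc i) 1) n
      ≡⟨ cong (f n xor_) (trans (shift-cong (k * 1) (pascal f i 0) n) (shift-⊕ (k * 1) (gauss f i 1) _ n)) ⟩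
    f n xor (shift (k * 1) (gauss f i 1) n xor shift (k * 1) (shift (k * suc i) f) n)
      ≡⟨ xor-assoc (f n) _ _ ⟨
    gauss f (suc i) 1 n xor shift (k * 1) (shift (k * suc i) f) n
      ≡⟨ cong (gauss f (suc i) 1 n xor_) (trans (shift-+ (k * 1) (k * suc i) f n) (shift-≡ f (exponents k i) n)) ⟩
    gauss f (suc i) 1 n xor shift (k * (2 + i)) f n ∎
    where
    open ≡-Reasoning
    exponents : ∀ k i → k * 1 + k * suc i ≡ k * (2 + i)
    exponents = solve 2 (λ k i → k :* con 1 :+ k :* (con 1 :+ i) := k :* (con 2 :+ i)) refl
      where
      open +-*-Solver
  pascal f (suc i) (suc j) n = begin
    gauss f (2 + i) (suc j) n xor shift (k * (2 + j)) (gauss f (suc i) (2 + j)) n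
      ≡⟨ cong₂ _xor_ (pascal f (suc i) j n)
           (trans (shift-cong (k * (2 + j)) (pascal f i (suc j)) n) (shift-⊕ (k * (2 + j)) (gauss f i (2 + j)) _ n)) ⟩
    (a xor b) xor (c xor shift (k * (2 + j)) (shift (k * suc i) (gauss f (suc i) (suc j))) n)
      ≡⟨ cong (λ z → (a xor b) xor (c xor z))
           (trans (shift-+ (k * (2 + j)) (k * suc i) _ n)
             (trans (shift-≡ _ (exponents k i j) n) (sym (shift-+ (k * (2 + i)) (k * suc j) _ n)))) ⟩
    (a xor b) xor (c xor e)
      ≡⟨ xor-interchange a b c e ⟩
    (a xor c) xor (b xor e)
      ≡⟨ cong ((a xor c) xor_) (shift-⊕ (k * (2 + i)) (gauss f (2 + i) j) _ n) ⟨
    gauss f (suc i) (2 + j) n xor shift (k * (2 + i)) (gauss f (2 + i) (suc j)) n ∎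
    where
    open ≡-Reasoning
    a b c e : Bool
    a = gauss f (suc i) (suc j) n
    b = shift (k * (2 + i)) (gauss f (2 + i) j) n
    c = shift (k * (2 + j)) (gauss f i (2 + j)) n
    e = shift (k * (2 + i)) (shift (k * suc j) (gauss f (suc i) (suc j))) n
    exponents : ∀ k i j → k * (2 + j) + k * suc i ≡ k * (2 + i) + k * suc j
    exponents = solve 3 (λ k i j → k :* (con 2 :+ j) :+ k :* (con 1 :+ i)
                                := k :* (con 2 :+ i) :+ k :* (con 1 :+ j)) refl
      where
      open +-*-Solver

  gauss-sym : ∀ f i j → gauss f i j ≗ gauss f j i
  gauss-sym f zero    zero    n = refl
  gauss-sym f zero    (suc j) n = refl
  gauss-sym f (suc i) zero    n = refl
  gauss-sym f (suc i) (suc j) n =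
    trans (cong₂ _xor_ (gauss-sym f (suc i) j n) (shift-cong (k * suc j) (gauss-sym f i (suc j)) n))
          (sym (pascal f j i n))

  -- The division-free substitute for the quotient formula: one Gaussian binomial is expanded by
  -- `pascal`, the other by definition, and the common middle term cancels modulo 2.
  gauss-absorb : ∀ f i j →
    1+q^ (k * suc i) · gauss f (suc i) j ≗ 1+q^ (k * suc (i + j)) · gauss f i j
  gauss-absorb f i zero n = cong₂ _xor_ (edge i n)
    (trans (shift-≡ f (cong (λ z → k * suc z) (sym (+-identityʳ i))) n)
           (shift-cong (k * suc (i + 0)) (edge i) n))
    where
    edge : ∀ i → f ≗ gauss f i 0
    edge zero    n = refl
    edge (suc i) n = refl
  gauss-absorb f i (suc j) n = begin
    gauss f (suc i) (suc j) n xor shift (k * suc i) (gauss f (suc i) j ⊕ shift (k * suc j) (gauss f i (suc j))) n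
      ≡⟨ cong₂ _xor_ (pascal f i j n) (shift-⊕ (k * suc i) (gauss f (suc i) j) _ n) ⟩
    (a xor b) xor (b xor shift (k * suc i) (shift (k * suc j) (gauss f i (suc j))) n)
      ≡⟨ xor-cancel a b _ ⟩
    a xor shift (k * suc i) (shift (k * suc j) (gauss f i (suc j))) n
      ≡⟨ cong (a xor_) (trans (shift-+ (k * suc i) (k * suc j) _ n) (shift-≡ _ (exponents k i j) n)) ⟩
    a xor shift (k * suc (i + suc j)) (gauss f i (suc j)) n ∎
    where
    open ≡-Reasoning
    a b : Bool
    a = gauss f i (suc j) n
    b = shift (k * suc i) (gauss f (suc i) j) n
    exponents : ∀ k i j → k * suc i + k * suc j ≡ k * suc (i + suc j)
    exponents = solve 3 (λ k i j → k :* (con 1 :+ i) :+ k :* (con 1 :+ j)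
                                := k :* (con 1 :+ (i :+ (con 1 :+ j)))) refl
      where
      open +-*-Solver

  -- The finite triple product

  terms : Series → ℕ → ℕ → ℕ → Series
  terms f s i j = shift (expo s i) (gauss f i j)

  -- The q-binomial theorem with exponents shifted so that negative powers of z = q do not occur.
  binomial-pos : ∀ f s r →
    1+q^ (k * r + 1) · antidiag (terms f s) (r + s) ≗ antidiag (terms f s) (suc (r + s))
  binomial-pos f s r n = sym (begin
    antidiag (terms f s) (suc (r + s)) n
      ≡⟨ antidiag-split₀ (terms f s) (terms f s) v (r + s) (λ j _ → refl) edge inner n ⟩
    antidiag (terms f s) (r + s) n xor antidiag v (r + s) n
      ≡⟨ cong (antidiag (terms f s) (r + s) n xor_) (antidiag-cong (r + s) shifted n) ⟩
    antidiag (terms f s) (r + s) n xor antidiag (λ i j → shift (k * r + 1) (terms f s i j)) (r + s) n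
      ≡⟨ cong (antidiag (terms f s) (r + s) n xor_) (antidiag-shift (k * r + 1) (terms f s) (r + s) n) ⟨
    (1+q^ (k * r + 1) · antidiag (terms f s) (r + s)) n ∎)
    where
    open ≡-Reasoning
    v : ℕ → ℕ → Series
    v i j = shift (expo s (suc i) + k * j) (gauss f i j)
    edge : ∀ i → terms f s (suc i) 0 ≗ v i 0
    edge zero    n = shift-≡ f (solve 2 (λ k a → a := a :+ k :* con 0) refl k (expo s 1)) n
      where
      open +-*-Solver
    edge (suc i) n = shift-≡ f (solve 2 (λ k a → a := a :+ k :* con 0) refl k (expo s (2 + i))) n
      where
      open +-*-Solver
    inner : ∀ i j → terms f s (suc i) (suc j) ≗ terms f s (suc i) j ⊕ v i (suc j)
    inner i j n = trans (shift-⊕ (expo s (suc i)) (gauss f (suc i) j) _ n)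
      (cong (terms f s (suc i) j n xor_) (shift-+ (expo s (suc i)) (k * suc j) _ n))
    exponents : ∀ i j → i + j ≡ r + s → expo s (suc i) + k * j ≡ k * r + 1 + expo s i
    exponents i j i+j≡r+s = +-cancelʳ-≡ (k * s) _ _ (begin
      expo s (suc i) + k * j + k * s
        ≡⟨ solve 3 (λ a b c → a :+ b :+ c := a :+ c :+ b) refl (expo s (suc i)) (k * j) (k * s) ⟩
      expo s (suc i) + k * s + k * j
        ≡⟨ cong (_+ k * j) (expo-step s i) ⟩
      expo s i + (k * i + 1) + k * j
        ≡⟨ solve 4 (λ k i j a → a :+ (k :* i :+ con 1) :+ k :* j := con 1 :+ a :+ k :* (i :+ j)) refl k i j (expo s i) ⟩
      1 + expo s i + k * (i + j)
        ≡⟨ cong (λ z → 1 + expo s i + k * z) i+j≡r+s ⟩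
      1 + expo s i + k * (r + s)
        ≡⟨ solve 4 (λ k r s a → con 1 :+ a :+ k :* (r :+ s) := k :* r :+ con 1 :+ a :+ k :* s) refl k r s (expo s i) ⟩
      k * r + 1 + expo s i + k * s ∎)
      where
      open +-*-Solver
    shifted : ∀ i j → i + j ≡ r + s → v i j ≗ shift (k * r + 1) (terms f s i j)
    shifted i j e n = trans (shift-≡ (gauss f i j) (exponents i j e) n)
      (sym (shift-+ (k * r + 1) (expo s i) (gauss f i j) n))

  -- Moving the origin from s to s + 1 renumbers the integer m - s. Hence the summand 1 of the
  -- factor sends term i to position i + 1, its power of q leaves term i in place, and the two meet
  -- by `pascal`.
  binomial-neg : ∀ f s M →
    1+q^ (k * s + suc d) · antidiag (terms f s) M ≗ antidiag (terms f (suc s)) (suc M)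
  binomial-neg f s M n = sym (begin
    antidiag (terms f (suc s)) (suc M) n
      ≡⟨ antidiag-split₀ (terms f (suc s)) u (terms f s) M first edge inner n ⟩
    antidiag u M n xor antidiag (terms f s) M n
      ≡⟨ cong (_xor antidiag (terms f s) M n) (antidiag-shift (k * s + suc d) (terms f s) M n) ⟨
    shift (k * s + suc d) (antidiag (terms f s) M) n xor antidiag (terms f s) M n
      ≡⟨ xor-comm _ (antidiag (terms f s) M n) ⟩
    (1+q^ (k * s + suc d) · antidiag (terms f s) M) n ∎)
    where
    open ≡-Reasoning
    u : ℕ → ℕ → Series
    u i j = shift (k * s + suc d) (terms f s i j)
    first : ∀ j → terms f (suc s) 0 (suc j) ≗ u 0 j
    first j n = trans (shift-≡ f (trans (+-comm (neg s) _) (cong (k * s + suc d +_) (sym (expo-zero s)))) n)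
      (sym (shift-+ (k * s + suc d) (expo s 0) f n))
    edge : ∀ i → terms f (suc s) (suc i) 0 ≗ terms f s i 0
    edge zero    n = refl
    edge (suc i) n = refl
    exponents : ∀ i → expo s i + k * suc i ≡ (k * s + suc d) + expo s (suc i)
    exponents i = begin
      expo s i + k * suc i
        ≡⟨ solve 3 (λ d i a → a :+ (con 2 :+ d) :* (con 1 :+ i)
             := a :+ ((con 2 :+ d) :* i :+ con 1) :+ (con 1 :+ d)) refl d i (expo s i) ⟩
      expo s i + (k * i + 1) + suc d
        ≡⟨ cong (_+ suc d) (expo-step s i) ⟨
      expo s (suc i) + k * s + suc d
        ≡⟨ solve 3 (λ a b c → a :+ b :+ c := b :+ c :+ a) refl (expo s (suc i)) (k * s) (suc d) ⟩
      (k * s + suc d) + expo s (suc i) ∎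
      where
      open +-*-Solver
    inner : ∀ i j → terms f (suc s) (suc i) (suc j) ≗ u (suc i) j ⊕ terms f s i (suc j)
    inner i j n = begin
      shift (expo s i) (gauss f (suc i) (suc j)) n
        ≡⟨ trans (shift-cong (expo s i) (pascal f i j) n) (shift-⊕ (expo s i) (gauss f i (suc j)) _ n) ⟩
      terms f s i (suc j) n xor shift (expo s i) (shift (k * suc i) (gauss f (suc i) j)) n
        ≡⟨ cong (terms f s i (suc j) n xor_)
             (trans (shift-+ (expo s i) (k * suc i) _ n)
               (trans (shift-≡ _ (exponents i) n) (sym (shift-+ (k * s + suc d) (expo s (suc i)) _ n)))) ⟩
      terms f s i (suc j) n xor u (suc i) j n
        ≡⟨ xor-comm (terms f s i (suc j) n) _ ⟩
      u (suc i) j n xor terms f s i (suc j) n ∎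

  pos-part neg-part all-part : ℕ → ℕ
  pos-part j = k * j + 1
  neg-part j = k * j + suc d
  all-part j = k * suc j

  binomial : ∀ f s r →
    ∏1+q neg-part s (∏1+q pos-part r f) ≗ antidiag (terms f s) (s + r)
  binomial f zero zero    n = refl
  binomial f zero (suc r) n =
    trans (1+q-cong (pos-part r) (binomial f 0 r) n)
      (subst (λ M → (1+q^ pos-part r · antidiag (terms f 0) M) n ≡ antidiag (terms f 0) (suc M) n)
        (+-identityʳ r) (binomial-pos f 0 r n))
  binomial f (suc s) r n =
    trans (1+q-cong (neg-part s) (binomial f s r) n) (binomial-neg f s (s + r) n)

  -- From the finite product to the theta series

  -- The product clears the denominator of the Gaussian binomial. What remains are the factors with
  -- exponents k (j + 1), ..., k (j + i), invisible below k (j + 1).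
  ∏-gauss : ∀ f i j → ∏1+q all-part i (gauss f i j) ≈[ k * suc j ] f
  ∏-gauss f zero    j n _ = refl
  ∏-gauss f (suc i) j n l = begin
    (1+q^ (k * suc i) · ∏1+q all-part i (gauss f (suc i) j)) n
      ≡⟨ ∏-1+q all-part i (k * suc i) (gauss f (suc i) j) n ⟨
    ∏1+q all-part i (1+q^ (k * suc i) · gauss f (suc i) j) n
      ≡⟨ ∏-cong all-part i (gauss-absorb f i j) n ⟩
    ∏1+q all-part i (1+q^ (k * suc (i + j)) · gauss f i j) n
      ≡⟨ ∏-1+q all-part i (k * suc (i + j)) (gauss f i j) n ⟩
    (1+q^ (k * suc (i + j)) · ∏1+q all-part i (gauss f i j)) n
      ≡⟨ 1+q-≈ (k * suc (i + j)) (∏1+q all-part i (gauss f i j)) n (<-≤-trans l (*-monoʳ-≤ k (s≤s (m≤n+m j i)))) ⟩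
    ∏1+q all-part i (gauss f i j) n
      ≡⟨ ∏-gauss f i j n l ⟩
    f n ∎
    where
    open ≡-Reasoning

  ∏-gauss-+ : ∀ f t {i j} → i ≤ j → ∏1+q all-part (t + i) (gauss f i j) ≈[ suc i ] f
  ∏-gauss-+ f zero    {i} {j} i≤j = ≈-weaken (≤-trans (s≤s i≤j) (m≤n*m (suc j) k)) (∏-gauss f i j)
  ∏-gauss-+ f (suc t) {i} {j} i≤j = ≈-trans
    (≈-weaken (≤-trans (s≤s (m≤n+m i t)) (m≤n*m (suc (t + i)) k)) (1+q-≈ (k * suc (t + i)) _))
    (∏-gauss-+ f t i≤j)

  ∏-gauss-≤ : ∀ f {N i j} → i ≤ N → i ≤ j → ∏1+q all-part N (gauss f i j) ≈[ suc i ] f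
  ∏-gauss-≤ f {N} {i} {j} i≤N i≤j =
    subst (λ M → ∏1+q all-part M (gauss f i j) ≈[ suc i ] f) (m∸n+n≡m i≤N) (∏-gauss-+ f (N ∸ i) i≤j)

  n≤pos : ∀ n → n ≤ pos n
  n≤pos zero    = z≤n
  n≤pos (suc n) = ≤-trans (≤-reflexive (+-comm 1 n)) (+-mono-≤ (n≤pos n) (m≤n+m 1 (k * n)))

  n≤neg : ∀ n → n ≤ neg n
  n≤neg zero    = z≤n
  n≤neg (suc n) = ≤-trans (≤-reflexive (+-comm 1 n))
    (+-mono-≤ (n≤neg n) (≤-trans (s≤s z≤n) (m≤n+m (suc d) (k * n))))

  s≤expo+m : ∀ s m → s ≤ expo s m + m
  s≤expo+m zero    m       = z≤n
  s≤expo+m (suc s) zero    = ≤-trans (n≤neg (suc s)) (m≤m+n _ 0)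
  s≤expo+m (suc s) (suc m) = ≤-trans (s≤s (s≤expo+m s m)) (≤-reflexive (sym (+-suc _ m)))

  m≤expo+s : ∀ s m → m ≤ expo s m + s
  m≤expo+s zero    m       = ≤-trans (n≤pos m) (m≤m+n _ 0)
  m≤expo+s (suc s) zero    = z≤n
  m≤expo+s (suc s) (suc m) = ≤-trans (s≤s (m≤expo+s s m)) (≤-reflexive (sym (+-suc _ s)))

  -- Clearing the denominator is exact only to order min(i, j) + 1, which is poor at the ends of the
  -- row. There the prefactor helps: `expo N i` is at least the distance of i from N, and this
  -- distance plus min(i, j) equals N because i + j = 2N.
  ∏-terms : ∀ f N i j → i + j ≡ N + N →
    ∏1+q all-part N (terms f N i j) ≈[ suc N ] shift (expo N i) f
  ∏-terms f N i j i+j≡2N = ≈-trans (≗⇒≈ (∏-shift all-part N (expo N i) (gauss f i j))) (bound (≤-total i N))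
    where
    open ≤-Reasoning
    bound : _ → shift (expo N i) (∏1+q all-part N (gauss f i j)) ≈[ suc N ] shift (expo N i) f
    bound (inj₁ i≤N) = ≈-weaken
      (≤-trans (s≤s (s≤expo+m N i)) (≤-reflexive (sym (+-suc _ i))))
      (shift-≈ (expo N i) (∏-gauss-≤ f i≤N (≤-trans i≤N N≤j)))
      where
      N≤j : N ≤ j
      N≤j = +-cancelˡ-≤ i N j (≤-trans (+-monoˡ-≤ N i≤N) (≤-reflexive (sym i+j≡2N)))
    bound (inj₂ N≤i) = ≈-weaken
      (≤-trans (s≤s N≤expo+j) (≤-reflexive (sym (+-suc _ j))))
      (shift-≈ (expo N i) (≈-trans (≗⇒≈ (∏-cong all-part N (gauss-sym f i j)))
                                   (∏-gauss-≤ f j≤N (≤-trans j≤N N≤i))))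
      where
      j≤N : j ≤ N
      j≤N = +-cancelˡ-≤ i j N (≤-trans (≤-reflexive i+j≡2N) (+-monoˡ-≤ N N≤i))
      N≤expo+j : N ≤ expo N i + j
      N≤expo+j = +-cancelʳ-≤ N N (expo N i + j) (begin
        N + N              ≡⟨ i+j≡2N ⟨
        i + j              ≤⟨ +-monoˡ-≤ j (m≤expo+s N i) ⟩
        expo N i + N + j   ≡⟨ solve 3 (λ a b c → a :+ b :+ c := a :+ c :+ b) refl (expo N i) N j ⟩
        expo N i + j + N   ∎)
        where
        open +-*-Solver

  -- The exponent 0 belongs to `pos` alone; `suc t` keeps it from being counted twice and
  -- cancelling.
  theta : Series → ℕ → Series
  theta f N n = ∑ (λ t → shift (neg (suc t)) f n) N xor ∑ (λ m → shift (pos m) f n) (suc N)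

  antidiag-theta : ∀ f s r n → antidiag (λ i _ → shift (expo s i) f) (s + r) n ≡
    ∑ (λ t → shift (neg (suc t)) f n) s xor ∑ (λ m → shift (pos m) f n) (suc r)
  antidiag-theta f zero    r n = antidiag-∑ (λ m → shift (pos m) f) r n
  antidiag-theta f (suc s) r n =
    trans (cong (shift (neg (suc s)) f n xor_) (antidiag-theta f s r n))
      (trans (sym (xor-assoc (shift (neg (suc s)) f n) negs poss))
             (cong (_xor poss) (xor-comm (shift (neg (suc s)) f n) negs)))
    where
    negs poss : Bool
    negs = ∑ (λ t → shift (neg (suc t)) f n) s
    poss = ∑ (λ m → shift (pos m) f n) (suc r)

  jacobi : ∀ f N →
    ∏1+q all-part N (∏1+q neg-part N (∏1+q pos-part N f)) ≈[ suc N ] theta f N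
  jacobi f N n l = begin
    ∏1+q all-part N (∏1+q neg-part N (∏1+q pos-part N f)) n
      ≡⟨ ∏-cong all-part N (binomial f N N) n ⟩
    ∏1+q all-part N (antidiag (terms f N) (N + N)) n
      ≡⟨ antidiag-∏ all-part N (terms f N) (N + N) n ⟩
    antidiag (λ i j → ∏1+q all-part N (terms f N i j)) (N + N) n
      ≡⟨ antidiag-≈ (N + N) (∏-terms f N) n l ⟩
    antidiag (λ i _ → shift (expo N i) f) (N + N) n
      ≡⟨ antidiag-theta f N N n ⟩
    theta f N n ∎
    where
    open ≡-Reasoning

  -- The triple product as a product over the residues 0 and ±1

  exceptional-+ : ∀ a K → exceptional k 1 ((a + k * K) % k) ≡ exceptional k 1 (a % k)
  exceptional-+ a K = cong (exceptional k 1)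
    (trans (cong (λ z → (a + z) % k) (*-comm k K)) ([m+kn]%n≡m%n a K k))

  exceptional-k-1 : exceptional k 1 (suc d) ≡ true
  exceptional-k-1 = trans (cong ((suc d ≡ᵇ 1) ∨_) (n≡ᵇn (suc d))) (∨-zeroʳ _)

  c : ℕ → Bool
  c a = exceptional k 1 (a % k)

  ∏≤-keep : ∀ M f → c (suc M) ≡ true → ∏≤ c (suc M) f ≡ 1+q^ suc M · ∏≤ c M f
  ∏≤-keep M f e rewrite e = refl

  ∏≤-skip : ∀ M f → c (suc M) ≡ false → ∏≤ c (suc M) f ≡ ∏≤ c M f
  ∏≤-skip M f e rewrite e = refl

  c-first : ∀ K → c (1 + k * K) ≡ true
  c-first K = exceptional-+ 1 K

  c-middle : ∀ j K → 2 + j ≤ d → c (2 + j + k * K) ≡ false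
  c-middle j K l = trans (exceptional-+ (2 + j) K)
    (trans (cong (exceptional k 1) (m<n⇒m%n≡m (s≤s (m≤n⇒m≤1+n l)))) (<⇒≢ᵇ {2 + j} {suc d} (s≤s l)))

  c-penultimate : ∀ K → c (suc d + k * K) ≡ true
  c-penultimate K = trans (exceptional-+ (suc d) K)
    (trans (cong (exceptional k 1) (m<n⇒m%n≡m {n = k} {m = suc d} ≤-refl)) exceptional-k-1)

  c-last : ∀ K → c (k + k * K) ≡ true
  c-last K = trans (exceptional-+ k K) (cong (exceptional k 1) (n%n≡0 k))

  ∏≤-middle : ∀ f K j → suc j ≤ d → ∏≤ c (suc j + k * K) f ≡ 1+q^ (1 + k * K) · ∏≤ c (k * K) f
  ∏≤-middle f K zero    l = ∏≤-keep (k * K) f (c-first K)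
  ∏≤-middle f K (suc j) l = trans (∏≤-skip (suc j + k * K) f (c-middle j K l))
    (∏≤-middle f K j (≤-trans (n≤1+n _) l))

  -- For `1 ≤ d` the residues 1 and k - 1 are distinct, so k consecutive exponents contribute
  -- exactly three factors. For k = 2 they would coincide, while the triple product would count the
  -- factor twice.
  ∏≤-block : ∀ f K → 1 ≤ d → ∏≤ c (k + k * K) f ≡
    1+q^ (k + k * K) · 1+q^ (suc d + k * K) · 1+q^ (1 + k * K) · ∏≤ c (k * K) f
  ∏≤-block f K 1≤d = trans (∏≤-keep (suc d + k * K) f (c-last K))
    (cong (1+q^ (k + k * K) ·_)
      (trans (∏≤-keep (d + k * K) f (c-penultimate K))
        (cong (1+q^ (suc d + k * K) ·_) (middle d 1≤d ≤-refl))))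
    where
    -- A separate variable is split into zero and successor here, because `d` is fixed by the module
    -- and occurs in `k`.
    middle : ∀ e → 1 ≤ e → e ≤ d → ∏≤ c (e + k * K) f ≡ 1+q^ (1 + k * K) · ∏≤ c (k * K) f
    middle (suc e) _ l = ∏≤-middle f K e l

  ∏≤-∏ : ∀ f K → 1 ≤ d →
    ∏≤ c (k * K) f ≗ ∏1+q all-part K (∏1+q neg-part K (∏1+q pos-part K f))
  ∏≤-∏ f zero 1≤d n = cong (λ M → ∏≤ c M f n) (*-comm k 0)
  ∏≤-∏ f (suc K) 1≤d n = begin
    ∏≤ c (k * suc K) f n
      ≡⟨ cong (λ M → ∏≤ c M f n) (*-suc k K) ⟩
    ∏≤ c (k + k * K) f n
      ≡⟨ cong (λ g → g n) (∏≤-block f K 1≤d) ⟩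
    (1+q^ (k + k * K) · 1+q^ (suc d + k * K) · 1+q^ (1 + k * K) · ∏≤ c (k * K) f) n
      ≡⟨ cong₂ (λ a b → (1+q^ a · 1+q^ b · 1+q^ (1 + k * K) · ∏≤ c (k * K) f) n) (sym (*-suc k K)) (+-comm (suc d) _) ⟩
    (1+q^ all-part K · 1+q^ neg-part K · 1+q^ (1 + k * K) · ∏≤ c (k * K) f) n
      ≡⟨ cong (λ a → (1+q^ all-part K · 1+q^ neg-part K · 1+q^ a · ∏≤ c (k * K) f) n) (+-comm 1 _) ⟩
    (1+q^ all-part K · 1+q^ neg-part K · 1+q^ pos-part K · ∏≤ c (k * K) f) n
      ≡⟨ 1+q-cong (all-part K) (1+q-cong (neg-part K) (1+q-cong (pos-part K) (∏≤-∏ f K 1≤d))) n ⟩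
    (1+q^ all-part K · 1+q^ neg-part K · 1+q^ pos-part K · A (B (C f))) n
      ≡⟨ 1+q-cong (all-part K) (1+q-cong (neg-part K) (∏-1+q all-part K (pos-part K) (B (C f)))) n ⟨
    (1+q^ all-part K · 1+q^ neg-part K · A (1+q^ pos-part K · B (C f))) n
      ≡⟨ 1+q-cong (all-part K) (∏-1+q all-part K (neg-part K) _) n ⟨
    (1+q^ all-part K · A (1+q^ neg-part K · 1+q^ pos-part K · B (C f))) n
      ≡⟨ 1+q-cong (all-part K) (∏-cong all-part K (1+q-cong (neg-part K) (∏-1+q neg-part K (pos-part K) (C f)))) n ⟨
    (1+q^ all-part K · A (1+q^ neg-part K · B (1+q^ pos-part K · C f))) n ∎
    where
    open ≡-Reasoning
    A B C : Series → Series
    A = ∏1+q all-part K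
    B = ∏1+q neg-part K
    C = ∏1+q pos-part K

  jacobi-∏≤ : ∀ f K → 1 ≤ d → ∏≤ c (k * K) f ≈[ suc K ] theta f K
  jacobi-∏≤ f K 1≤d = ≈-trans (≗⇒≈ (∏≤-∏ f K 1≤d)) (jacobi f K)

-- Rearranging products over selected exponents

1+q-comm : ∀ a b f → 1+q^ a · 1+q^ b · f ≗ 1+q^ b · 1+q^ a · f
1+q-comm a b f = ∏-1+q (λ _ → a) 1 b f

∏≤-cong : ∀ c M {f g} → f ≗ g → ∏≤ c M f ≗ ∏≤ c M g
∏≤-cong c zero    p = p
∏≤-cong c (suc M) p with c (suc M)
... | true  = 1+q-cong (suc M) (∏≤-cong c M p)
... | false = ∏≤-cong c M p

∏≤-≈ : ∀ c M {K f g} → f ≈[ K ] g → ∏≤ c M f ≈[ K ] ∏≤ c M g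
∏≤-≈ c zero    p = p
∏≤-≈ c (suc M) p with c (suc M)
... | true  = 1+q-≈-cong (suc M) (∏≤-≈ c M p)
... | false = ∏≤-≈ c M p

∏≤-1+q : ∀ c M b f → ∏≤ c M (1+q^ b · f) ≗ 1+q^ b · ∏≤ c M f
∏≤-1+q c zero    b f n = refl
∏≤-1+q c (suc M) b f n with c (suc M)
... | true  = trans (1+q-cong (suc M) (∏≤-1+q c M b f) n) (1+q-comm (suc M) b (∏≤ c M f) n)
... | false = ∏≤-1+q c M b f n

∏≤-cond : ∀ {c c′} M f → c ≗ c′ → ∏≤ c M f ≡ ∏≤ c′ M f
∏≤-cond zero    f p = refl
∏≤-cond (suc M) f p rewrite p (suc M) | ∏≤-cond M f p = refl

∏≤-split : ∀ c M f → ∏≤ (λ _ → true) M f ≗ ∏≤ c M (∏≤ (not ∘ c) M f)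
∏≤-split c zero    f n = refl
∏≤-split c (suc M) f n with c (suc M)
... | true  = 1+q-cong (suc M) (∏≤-split c M f) n
... | false = trans (1+q-cong (suc M) (∏≤-split c M f) n) (sym (∏≤-1+q c M (suc M) _ n))

-- With `b = false` this also says that the zero series stays zero under a shift.
shift-∧ : ∀ b a f → shift a (λ m → b ∧ f m) ≗ (λ m → b ∧ shift a f m)
shift-∧ b zero    f n       = refl
shift-∧ b (suc a) f zero    = sym (∧-zeroʳ b)
shift-∧ b (suc a) f (suc n) = shift-∧ b a f n

shift-≡ᵇ : ∀ a s n → (a + s ≡ᵇ n) ≡ shift a (s ≡ᵇ_) n
shift-≡ᵇ zero    s n       = refl
shift-≡ᵇ (suc a) s zero    = refl
shift-≡ᵇ (suc a) s (suc n) = shift-≡ᵇ a s n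

-- Parity of the number of list elements satisfying a test

odd : ℕ → Bool
odd zero    = false
odd (suc n) = not (odd n)

odd⇒%2 : ∀ n → odd n ≡ true → n % 2 ≡ 1
odd⇒%2 (suc zero)    _ = refl
odd⇒%2 (suc (suc n)) p = odd⇒%2 n (trans (sym (not-involutive (odd n))) p)

module _ {A : Set} where

  parity : (A → Bool) → List A → Bool
  parity P []       = false
  parity P (x ∷ xs) = P x xor parity P xs

  odd-length-filter : ∀ P xs → odd (length (filterᵇ P xs)) ≡ parity P xs
  odd-length-filter P []       = refl
  odd-length-filter P (x ∷ xs) with P x
  ... | true  = cong not (odd-length-filter P xs)
  ... | false = odd-length-filter P xs

  parity-cong : ∀ {P Q} → P ≗ Q → ∀ xs → parity P xs ≡ parity Q xs
  parity-cong p []       = refl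
  parity-cong p (x ∷ xs) = cong₂ _xor_ (p x) (parity-cong p xs)

  parity-++ : ∀ P xs ys → parity P (xs ++ ys) ≡ parity P xs xor parity P ys
  parity-++ P []       ys = refl
  parity-++ P (x ∷ xs) ys = trans (cong (P x xor_) (parity-++ P xs ys)) (sym (xor-assoc (P x) _ _))

  parity-applyUpTo : ∀ (P : A → Bool) (g : ℕ → A) n → parity P (applyUpTo g n) ≡ ∑ (P ∘ g) n
  parity-applyUpTo P g zero    = refl
  parity-applyUpTo P g (suc n) =
    trans (cong (P (g 0) xor_) (parity-applyUpTo P (g ∘ suc) n)) (sym (∑-front (P ∘ g) n))

  parity-∧ : ∀ b P xs → parity (λ x → b ∧ P x) xs ≡ b ∧ parity P xs
  parity-∧ b P []       = sym (∧-zeroʳ b)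
  parity-∧ b P (x ∷ xs) = trans (cong ((b ∧ P x) xor_) (parity-∧ b P xs)) (sym (∧-distribˡ-xor b (P x) _))

  parity-shift : ∀ a (P : ℕ → A → Bool) n xs →
    parity (λ x → shift a (λ m → P m x) n) xs ≡ shift a (λ m → parity (P m) xs) n
  parity-shift a P n []       = sym (shift-∧ false a (λ _ → false) n)
  parity-shift a P n (x ∷ xs) =
    trans (cong (shift a (λ m → P m x) n xor_) (parity-shift a P n xs))
          (sym (shift-⊕ a (λ m → P m x) (λ m → parity (P m) xs) n))

module _ {A B : Set} where

  parity-map : ∀ P (g : A → B) xs → parity P (map g xs) ≡ parity (P ∘ g) xs
  parity-map P g []       = refl
  parity-map P g (x ∷ xs) = cong (P (g x) xor_) (parity-map P g xs)

  parity-concatMap : ∀ P (g : A → List B) xs → parity P (concatMap g xs) ≡ parity (λ x → parity P (g x)) xs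
  parity-concatMap P g []       = refl
  parity-concatMap P g (x ∷ xs) =
    trans (parity-++ P (g x) (concatMap g xs)) (cong (parity P (g x) xor_) (parity-concatMap P g xs))

parity-words-suc : ∀ {A : Set} (P : List A → Bool) alph L →
  parity P (words alph (suc L)) ≡ parity (λ x → parity (λ w → P (x ∷ w)) (words alph L)) alph
parity-words-suc P alph L = trans (parity-concatMap P _ alph)
  (parity-cong (λ x → parity-map P (x ∷_) (words alph L)) alph)

parity-pairs : ∀ {A : Set} (P : A × Bool → Bool) xs →
  parity P (cartesianProduct xs (true ∷ false ∷ [])) ≡ parity (λ a → P (a , true) xor P (a , false)) xs
parity-pairs P []       = refl
parity-pairs P (a ∷ xs) =
  trans (cong (λ z → P (a , true) xor (P (a , false) xor z)) (parity-pairs P xs))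
        (sym (xor-assoc (P (a , true)) (P (a , false)) _))

parity-entries : ∀ (P : Entry → Bool) n →
  parity P (entries n) ≡ ∑ (λ b → P (suc b , true) xor P (suc b , false)) n
parity-entries P n = trans (parity-pairs P (applyUpTo suc n)) (parity-applyUpTo _ suc n)

∑-truncate : ∀ h {a n} → a ≤ n → (∀ b → a ≤ b → h b ≡ false) → ∑ h n ≡ ∑ h a
∑-truncate h {n = zero}  z≤n p = refl
∑-truncate h {a} {suc n} a≤n p with m≤n⇒m<n∨m≡n a≤n
... | inj₁ (s≤s a≤n′) = trans (cong₂ _xor_ (∑-truncate h a≤n′ p) (p n a≤n′)) (xor-identityʳ _)
... | inj₂ refl       = refl

<⇒<ᵇ : ∀ {m n} → m < n → (m <ᵇ n) ≡ true
<⇒<ᵇ {zero}  (s≤s _) = refl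
<⇒<ᵇ {suc m} (s≤s l) = <⇒<ᵇ l

≥⇒≮ᵇ : ∀ {m n} → n ≤ m → (m <ᵇ n) ≡ false
≥⇒≮ᵇ {m}     z≤n     = refl
≥⇒≮ᵇ {suc m} (s≤s l) = ≥⇒≮ᵇ l

≡ᵇ-sym : ∀ m n → (m ≡ᵇ n) ≡ (n ≡ᵇ m)
≡ᵇ-sym zero    zero    = refl
≡ᵇ-sym zero    (suc n) = refl
≡ᵇ-sym (suc m) zero    = refl
≡ᵇ-sym (suc m) (suc n) = ≡ᵇ-sym m n

0≡ᵇ : ∀ m → (0 ≡ᵇ m) ≡ δ m
0≡ᵇ zero    = refl
0≡ᵇ (suc m) = refl

-- Counting overpartitions modulo 2

module Overpartitions (k₁ i : ℕ) where

  k : ℕ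
  k = suc k₁

  ok : Entry → Bool
  ok = entryOKᵇ k i

  valid : ℕ → List Entry → Bool
  valid = isCkiOverpartitionᵇ k i

  allowed : ℕ → Bool
  allowed a = not (exceptional k i (a % k))

  -- At the residues ±i both versions of a part are admissible and cancel; at 0 neither is;
  -- elsewhere only the plain one is, and it survives.
  ok-xor : ∀ b s → (ok (suc b , true) ∧ s) xor (ok (suc b , false) ∧ s) ≡ allowed (suc b) ∧ s
  ok-xor b s = trans (sym (∧-distribʳ-xor s (ok (suc b , true)) (ok (suc b , false))))
    (cong (_∧ s) (cases (suc b % k ≡ᵇ 0) ((suc b % k ≡ᵇ i) ∨ (suc b % k ≡ᵇ k ∸ i))))
    where
    cases : ∀ x y → (not x ∧ y) xor (not x ∧ true) ≡ not (x ∨ y)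
    cases false false = refl
    cases false true  = refl
    cases true  y     = refl

  allowed⇒ok : ∀ a → allowed (suc a) ≡ true → ok (suc a , false) ≡ true
  allowed⇒ok a e with suc a % k ≡ᵇ 0
  ... | false = refl

  -- The conditions couple only neighbouring entries and see only the size of the earlier one, so
  -- this size is all that a continuation must know.
  after : ℕ → ℕ → List Entry → Bool
  after a m []            = 0 ≡ᵇ m
  after a m ((b , o) ∷ w) = ((b ≤ᵇ a) ∧ (not o ∨ not (a ≡ᵇ b))) ∧ valid m ((b , o) ∷ w)

  valid-∷ : ∀ m a o w → valid m ((a , o) ∷ w) ≡ ok (a , o) ∧ shift a (λ m → after a m w) m
  valid-∷ m a o [] =
    trans (cong₂ _∧_ (shift-≡ᵇ a 0 m) (∧-identityʳ (ok (a , o)))) (∧-comm _ (ok (a , o)))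
  valid-∷ m a o ((b , o′) ∷ w) = begin
    (a + s ≡ᵇ m) ∧ ((g₁ ∧ x) ∧ ((g₂ ∧ y) ∧ (ok (a , o) ∧ z)))
      ≡⟨ cong (_∧ ((g₁ ∧ x) ∧ ((g₂ ∧ y) ∧ (ok (a , o) ∧ z)))) (shift-≡ᵇ a s m) ⟩
    shift a (s ≡ᵇ_) m ∧ ((g₁ ∧ x) ∧ ((g₂ ∧ y) ∧ (ok (a , o) ∧ z)))
      ≡⟨ solve 7 (λ t g₁ x g₂ y e z → t :* ((g₁ :* x) :* ((g₂ :* y) :* (e :* z)))
           := e :* ((g₁ :* g₂) :* ((x :* (y :* z)) :* t))) refl
           (shift a (s ≡ᵇ_) m) g₁ x g₂ y (ok (a , o)) z ⟩
    ok (a , o) ∧ ((g₁ ∧ g₂) ∧ ((x ∧ (y ∧ z)) ∧ shift a (s ≡ᵇ_) m))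
      ≡⟨ cong (λ t → ok (a , o) ∧ ((g₁ ∧ g₂) ∧ t)) (shift-∧ (x ∧ (y ∧ z)) a (s ≡ᵇ_) m) ⟨
    ok (a , o) ∧ ((g₁ ∧ g₂) ∧ shift a (λ m → (x ∧ (y ∧ z)) ∧ (s ≡ᵇ m)) m)
      ≡⟨ cong (ok (a , o) ∧_) (shift-∧ (g₁ ∧ g₂) a _ m) ⟨
    ok (a , o) ∧ shift a (λ m → (g₁ ∧ g₂) ∧ ((x ∧ (y ∧ z)) ∧ (s ≡ᵇ m))) m
      ≡⟨ cong (ok (a , o) ∧_) (shift-cong a (λ m → cong ((g₁ ∧ g₂) ∧_) (∧-comm (x ∧ (y ∧ z)) (s ≡ᵇ m))) m) ⟩
    ok (a , o) ∧ shift a (λ m → after a m ((b , o′) ∷ w)) m ∎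
    where
    open ≡-Reasoning
    open xor-∧-Solver
    s : ℕ
    s = partSum ((b , o′) ∷ w)
    g₁ g₂ x y z : Bool
    g₁ = b ≤ᵇ a
    g₂ = not o′ ∨ not (a ≡ᵇ b)
    x = nonIncreasingᵇ ((b , o′) ∷ w)
    y = firstOccOverlineᵇ ((b , o′) ∷ w)
    z = allᵇ ok ((b , o′) ∷ w)

  -- The ways, mod 2, to continue with L further entries after a part of size a + 1 (tails), or to
  -- start with largest part at most a (heads).  An overlined and a plain part of residue ±i cancel,
  -- except that a repetition of the part a + 1 cannot be overlined.
  mutual
    tails : ℕ → ℕ → Series
    tails zero    a m = δ m
    tails (suc L) a m = heads (suc L) a m xor (ok (suc a , false) ∧ shift (suc a) (tails L a) m)

    heads : ℕ → ℕ → Series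
    heads zero    a m = δ m
    heads (suc L) a m = ∑ (λ b → allowed (suc b) ∧ shift (suc b) (tails L b) m) a

  mutual
    after-parity : ∀ N L a m → a < N → parity (after (suc a) m) (words (entries N) L) ≡ tails L a m
    after-parity N zero    a m a<N = trans (xor-identityʳ (0 ≡ᵇ m)) (0≡ᵇ m)
    after-parity N (suc L) a m a<N = begin
      parity (after (suc a) m) (words (entries N) (suc L))
        ≡⟨ parity-words-suc (after (suc a) m) (entries N) L ⟩
      parity (λ e → parity (λ w → after (suc a) m (e ∷ w)) (words (entries N) L)) (entries N)
        ≡⟨ parity-entries _ N ⟩
      ∑ (λ b → next b true xor next b false) N
        ≡⟨ ∑-cong N (λ b b<N → cong₂ _xor_ (next-parity b true b<N) (next-parity b false b<N)) ⟩
      ∑ term N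
        ≡⟨ ∑-truncate term a<N beyond ⟩
      ∑ term a xor term a
        ≡⟨ cong₂ _xor_ (∑-cong a below) at ⟩
      tails (suc L) a m ∎
      where
      open ≡-Reasoning
      next : ℕ → Bool → Bool
      next b o = parity (λ w → after (suc a) m ((suc b , o) ∷ w)) (words (entries N) L)
      guard : ℕ → Bool → Bool
      guard b o = (b <ᵇ suc a) ∧ (not o ∨ not (a ≡ᵇ b))
      term : ℕ → Bool
      term b = (guard b true ∧ (ok (suc b , true) ∧ shift (suc b) (tails L b) m))
           xor (guard b false ∧ (ok (suc b , false) ∧ shift (suc b) (tails L b) m))
      next-parity : ∀ b o → b < N → next b o ≡ guard b o ∧ (ok (suc b , o) ∧ shift (suc b) (tails L b) m)
      next-parity b o b<N = trans (parity-∧ (guard b o) (λ w → valid m ((suc b , o) ∷ w)) (words (entries N) L))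
        (cong (guard b o ∧_) (head-parity N L b o m b<N))
      beyond : ∀ b → a < b → term b ≡ false
      beyond b l rewrite ≥⇒≮ᵇ l = refl
      below : ∀ b → b < a → term b ≡ allowed (suc b) ∧ shift (suc b) (tails L b) m
      below b l rewrite <⇒<ᵇ (m≤n⇒m≤1+n l) | ≡ᵇ-sym a b | <⇒≢ᵇ l = ok-xor b _
      at : term a ≡ ok (suc a , false) ∧ shift (suc a) (tails L a) m
      at rewrite <⇒<ᵇ (n<1+n a) | n≡ᵇn a = refl

    head-parity : ∀ N L b o m → b < N →
      parity (λ w → valid m ((suc b , o) ∷ w)) (words (entries N) L)
        ≡ ok (suc b , o) ∧ shift (suc b) (tails L b) m
    head-parity N L b o m b<N = begin
      parity (λ w → valid m ((suc b , o) ∷ w)) ws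
        ≡⟨ parity-cong (valid-∷ m (suc b) o) ws ⟩
      parity (λ w → ok (suc b , o) ∧ shift (suc b) (λ m → after (suc b) m w) m) ws
        ≡⟨ parity-∧ (ok (suc b , o)) _ ws ⟩
      ok (suc b , o) ∧ parity (λ w → shift (suc b) (λ m → after (suc b) m w) m) ws
        ≡⟨ cong (ok (suc b , o) ∧_) (parity-shift (suc b) (after (suc b)) m ws) ⟩
      ok (suc b , o) ∧ shift (suc b) (λ m → parity (after (suc b) m) ws) m
        ≡⟨ cong (ok (suc b , o) ∧_) (shift-cong (suc b) (λ m → after-parity N L b m b<N) m) ⟩
      ok (suc b , o) ∧ shift (suc b) (tails L b) m ∎
      where
      open ≡-Reasoning
      ws : List (List Entry)
      ws = words (entries N) L

  valid-parity : ∀ N L m → parity (valid m) (words (entries N) L) ≡ heads L N m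
  valid-parity N zero    m = trans (xor-identityʳ _) (trans (∧-identityʳ (0 ≡ᵇ m)) (0≡ᵇ m))
  valid-parity N (suc L) m = trans (parity-words-suc (valid m) (entries N) L)
    (trans (parity-entries _ N)
      (∑-cong N (λ b b<N →
        trans (cong₂ _xor_ (head-parity N L b true m b<N) (head-parity N L b false m b<N)) (ok-xor b _))))

  -- The generating function and its denominators

  oddness : Series
  oddness n = odd (Cbar k i n)

  -- Two cut-offs, on the number of entries and on the largest part, keep the sum finite and allow
  -- induction on the part size; `genfun-stable` removes both.
  genfun : ℕ → ℕ → Series
  genfun L a n = ∑ (λ j → heads j a n) L

  oddness≡genfun : ∀ n → oddness n ≡ genfun (suc n) n n
  oddness≡genfun n = trans (odd-length-filter (valid n) (candidates n))
    (trans (parity-concatMap (valid n) (words (entries n)) (upTo (suc n)))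
      (trans (parity-applyUpTo _ id (suc n)) (∑-cong (suc n) (λ L _ → valid-parity n L n))))

  shift-vanish : ∀ b f {L} → (∀ m → m < L → f m ≡ false) → ∀ m → m < suc L → shift (suc b) f m ≡ false
  shift-vanish b f p m l =
    trans (shift-≈ (suc b) {g = λ _ → false} p m (<-≤-trans l (s≤s (m≤n+m _ b))))
          (shift-∧ false (suc b) f m)

  tails-vanish : ∀ L a m → m < L → tails L a m ≡ false
  heads-vanish : ∀ L a m → m < L → heads L a m ≡ false
  tails-vanish (suc L) a m l = cong₂ _xor_ (heads-vanish (suc L) a m l)
    (trans (cong (ok (suc a , false) ∧_) (shift-vanish a (tails L a) (tails-vanish L a) m l)) (∧-zeroʳ _))
  heads-vanish (suc L) a m l = ∑-truncate _ {0} {a} z≤n (λ b _ →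
    trans (cong (allowed (suc b) ∧_) (shift-vanish b (tails L b) (tails-vanish L b) m l)) (∧-zeroʳ _))

  heads-stable : ∀ L {M} n → n ≤ M → heads L M n ≡ heads L n n
  heads-stable zero    n n≤M = refl
  heads-stable (suc L) n n≤M = ∑-truncate _ n≤M (λ b n≤b →
    trans (cong (allowed (suc b) ∧_) (shift-below (suc b) (tails L b) n (s≤s n≤b))) (∧-zeroʳ _))

  -- A list with sum n has at most n entries, each at most n, so larger cut-offs add nothing.
  genfun-stable : ∀ {L M} n → n < L → n ≤ M → genfun L M n ≡ oddness n
  genfun-stable {L} {M} n n<L n≤M = begin
    ∑ (λ j → heads j M n) L        ≡⟨ ∑-truncate _ n<L (λ j l → heads-vanish j M n l) ⟩
    ∑ (λ j → heads j M n) (suc n)  ≡⟨ ∑-cong (suc n) (λ j _ → heads-stable j n n≤M) ⟩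
    genfun (suc n) n n             ≡⟨ oddness≡genfun n ⟨
    oddness n                      ∎
    where
    open ≡-Reasoning

  -- An allowed part has no overlined version, so the ban on overlining a repetition is void:
  -- continuing after it is the same as starting afresh with it as the bound.
  tails≗heads : ∀ L a → allowed (suc a) ≡ true → tails L a ≗ heads L (suc a)
  tails≗heads zero    a e m = refl
  tails≗heads (suc L) a e m rewrite e | allowed⇒ok a e = refl

  heads-suc : ∀ L a m → heads (suc L) (suc a) m ≡
    heads (suc L) a m xor (allowed (suc a) ∧ shift (suc a) (heads L (suc a)) m)
  heads-suc L a m = cong (heads (suc L) a m xor_) (replace (allowed (suc a)) refl)
    where
    replace : ∀ b → allowed (suc a) ≡ b →
      b ∧ shift (suc a) (tails L a) m ≡ b ∧ shift (suc a) (heads L (suc a)) m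
    replace false e = refl
    replace true  e = shift-cong (suc a) (tails≗heads L a e) m

  genfun-suc : ∀ L a n → genfun (suc L) (suc a) n ≡
    genfun (suc L) a n xor (allowed (suc a) ∧ shift (suc a) (genfun L (suc a)) n)
  genfun-suc zero    a n = sym (trans (cong (δ n xor_)
    (trans (cong (allowed (suc a) ∧_) (shift-∧ false (suc a) (λ _ → false) n)) (∧-zeroʳ _))) (xor-identityʳ (δ n)))
  genfun-suc (suc L) a n = begin
    genfun (suc L) (suc a) n xor heads (suc L) (suc a) n
      ≡⟨ cong₂ _xor_ (genfun-suc L a n) (heads-suc L a n) ⟩
    (g xor (b ∧ s)) xor (h xor (b ∧ t))
      ≡⟨ xor-interchange g (b ∧ s) h (b ∧ t) ⟩
    (g xor h) xor ((b ∧ s) xor (b ∧ t))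
      ≡⟨ cong ((g xor h) xor_) (∧-distribˡ-xor b s t) ⟨
    (g xor h) xor (b ∧ (s xor t))
      ≡⟨ cong (λ z → (g xor h) xor (b ∧ z)) (shift-⊕ (suc a) (genfun L (suc a)) (heads L (suc a)) n) ⟨
    genfun (suc (suc L)) a n xor (b ∧ shift (suc a) (genfun (suc L) (suc a)) n) ∎
    where
    open ≡-Reasoning
    b g h s t : Bool
    b = allowed (suc a)
    g = genfun (suc L) a n
    h = heads (suc L) a n
    s = shift (suc a) (genfun L (suc a)) n
    t = shift (suc a) (heads L (suc a)) n

  -- The recurrence `genfun-suc` telescopes except that its right side admits one entry fewer. The
  -- discrepancy comes from lists of maximal length, whose sums lie beyond the stated precision.
  genfun-keep : ∀ L a → allowed (suc a) ≡ true → 1+q^ suc a · genfun L (suc a) ≈[ L ] genfun L a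
  genfun-keep (suc L) a e n l = begin
    genfun (suc L) (suc a) n xor shift (suc a) (genfun L (suc a) ⊕ heads L (suc a)) n
      ≡⟨ cong₂ _xor_ (trans (genfun-suc L a n) (cong (λ b → g xor (b ∧ s)) e))
           (trans (shift-⊕ (suc a) (genfun L (suc a)) (heads L (suc a)) n)
             (cong (s xor_) (shift-vanish a (heads L (suc a)) (heads-vanish L (suc a)) n l))) ⟩
    (g xor s) xor (s xor false)
      ≡⟨ xor-cancel g s false ⟩
    g xor false
      ≡⟨ xor-identityʳ g ⟩
    g ∎
    where
    open ≡-Reasoning
    g s : Bool
    g = genfun (suc L) a n
    s = shift (suc a) (genfun L (suc a)) n

  genfun-skip : ∀ L a → allowed (suc a) ≡ false → genfun L (suc a) ≗ genfun L a
  genfun-skip zero    a e n = refl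
  genfun-skip (suc L) a e n = trans (genfun-suc L a n)
    (trans (cong (λ b → genfun (suc L) a n xor (b ∧ shift (suc a) (genfun L (suc a)) n)) e)
           (xor-identityʳ _))

  genfun-zero : ∀ L → genfun (suc L) 0 ≗ δ
  genfun-zero L n = ∑-truncate (λ j → heads j 0 n) {1} {suc L} (s≤s z≤n) λ { (suc j) _ → refl }

  -- The denominators are cleared one at a time, from the largest part down.
  ∏≤-genfun : ∀ L M → ∏≤ allowed M (genfun L M) ≈[ L ] genfun L 0
  ∏≤-genfun L zero    n l = refl
  ∏≤-genfun L (suc M) n l = trans (step (allowed (suc M)) refl) (∏≤-genfun L M n l)
    where
    step : ∀ b → allowed (suc M) ≡ b →
      ∏≤ allowed (suc M) (genfun L (suc M)) n ≡ ∏≤ allowed M (genfun L M) n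
    step true e = trans (keep e)
      (trans (sym (∏≤-1+q allowed M (suc M) (genfun L (suc M)) n))
             (∏≤-≈ allowed M (genfun-keep L M e) n l))
      where
      keep : allowed (suc M) ≡ true →
        ∏≤ allowed (suc M) (genfun L (suc M)) n ≡ (1+q^ suc M · ∏≤ allowed M (genfun L (suc M))) n
      keep e rewrite e = refl
    step false e = trans (skip e) (∏≤-cong allowed M (genfun-skip L M e) n)
      where
      skip : allowed (suc M) ≡ false →
        ∏≤ allowed (suc M) (genfun L (suc M)) n ≡ ∏≤ allowed M (genfun L (suc M)) n
      skip e rewrite e = refl

-- Comparison of coefficients at a pentagonal number

∑-false : ∀ h n → (∀ i → i < n → h i ≡ false) → ∑ h n ≡ false
∑-false h zero    p = refl
∑-false h (suc n) p = cong₂ _xor_ (∑-false h n (λ i l → p i (m≤n⇒m≤1+n l))) (p n ≤-refl)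

∑-single : ∀ h {a n} → a < n → h a ≡ true → (∀ i → i ≢ a → h i ≡ false) → ∑ h n ≡ true
∑-single h {a} {suc n} (s≤s a≤n) t p with m≤n⇒m<n∨m≡n a≤n
... | inj₁ a<n  = cong₂ _xor_ (∑-single h a<n t p) (p n (<⇒≢ a<n ∘ sym))
... | inj₂ refl = cong₂ _xor_ (∑-false h n (λ i l → p i (<⇒≢ l))) t

shift-δ : ∀ a n → a ≢ n → shift a δ n ≡ false
shift-δ zero    zero    ne = ⊥-elim (ne refl)
shift-δ zero    (suc n) ne = refl
shift-δ (suc a) zero    ne = refl
shift-δ (suc a) (suc n) ne = shift-δ a n (ne ∘ cong suc)

-- Here `pos n` is n (3n - 1) / 2 and `neg n` is n (3n + 1) / 2.
module J₃ = Jacobi 1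

c₃-true : ∀ a → true ≡ J₃.c a
c₃-true a = cases (a % 3) (m%n<n a 3)
  where
  cases : ∀ r → r < 3 → true ≡ exceptional 3 1 r
  cases 0 _ = refl
  cases 1 _ = refl
  cases 2 _ = refl
  cases (suc (suc (suc r))) (s≤s (s≤s (s≤s ())))

pos-gap : ∀ {m} l → m < suc l → J₃.pos m + l ≤ J₃.pos (suc l)
pos-gap {m} l (s≤s m≤l) = +-mono-≤ (J₃.pos-≤ m≤l) (≤-trans (m≤n*m l 3) (m≤m+n (3 * l) 1))

-- The critical neighbour: `neg l` is the last pentagonal number before `pos (suc l)`, at distance
-- 2l + 1.
neg-gap : ∀ {m} l → m < suc l → J₃.neg m + l ≤ J₃.pos (suc l)
neg-gap {m} l (s≤s m≤l) = begin
  J₃.neg m + l               ≤⟨ +-monoˡ-≤ l (J₃.neg-≤ m≤l) ⟩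
  J₃.neg l + l               ≡⟨ cong (_+ l) (J₃.neg≡pos+ l) ⟩
  J₃.pos l + l * 1 + l       ≤⟨ m≤m+n _ (l + 1) ⟩
  J₃.pos l + l * 1 + l + (l + 1)
    ≡⟨ solve 2 (λ x l → x :+ l :* con 1 :+ l :+ (l :+ con 1) := x :+ (con 3 :* l :+ con 1)) refl (J₃.pos l) l ⟩
  J₃.pos (suc l)             ∎
  where
  open ≤-Reasoning
  open +-*-Solver

neg-beyond : ∀ {m} l → suc l ≤ m → J₃.pos (suc l) < J₃.neg m
neg-beyond {m} l l<m = begin-strict
  J₃.pos (suc l)                 <⟨ m<m+n _ (s≤s z≤n) ⟩
  J₃.pos (suc l) + suc l * 1     ≡⟨ J₃.neg≡pos+ (suc l) ⟨
  J₃.neg (suc l)                 ≤⟨ J₃.neg-≤ l<m ⟩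
  J₃.neg m                       ∎
  where
  open ≤-Reasoning

module Parity (e : ℕ) where
  module J = Jacobi (suc e)
  open Overpartitions (2 + e) 1

  -- Both sides are the coefficient of q^N in the full product applied to the parity series. Split
  -- by residue, its allowed factors turn that series into `δ`, and the exceptional ones remain.
  theta-recurrence : ∀ N → J₃.theta oddness (k * N) N ≡ J.theta δ (3 * N) N
  theta-recurrence N = begin
    J₃.theta oddness (k * N) N
      ≡⟨ J₃.jacobi-∏≤ oddness (k * N) (s≤s z≤n) N (s≤s (m≤n*m N k)) ⟨
    ∏≤ J₃.c M oddness N
      ≡⟨ cong (λ g → g N) (∏≤-cond M oddness c₃-true) ⟨
    ∏≤ (λ _ → true) M oddness N
      ≡⟨ ∏≤-≈ (λ _ → true) M oddness≈G N ≤-refl ⟩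
    ∏≤ (λ _ → true) M G N
      ≡⟨ ∏≤-split J.c M G N ⟩
    ∏≤ J.c M (∏≤ allowed M G) N
      ≡⟨ ∏≤-≈ J.c M (≈-trans (∏≤-genfun (suc N) M) (≗⇒≈ (genfun-zero N))) N ≤-refl ⟩
    ∏≤ J.c M δ N
      ≡⟨ cong (λ M → ∏≤ J.c M δ N) (x∙yz≈y∙xz *-commutativeSemigroup 3 k N) ⟩
    ∏≤ J.c (k * (3 * N)) δ N
      ≡⟨ J.jacobi-∏≤ δ (3 * N) (s≤s z≤n) N (s≤s (m≤n*m N 3)) ⟩
    J.theta δ (3 * N) N ∎
    where
    open ≡-Reasoning
    M : ℕ
    -- The cut-off must be a multiple of 3 and of k, so that both triple products end with a
    -- complete block.
    M = 3 * (k * N)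
    G : Series
    G = genfun (suc N) M
    oddness≈G : oddness ≈[ suc N ] G
    oddness≈G n (s≤s n≤N) =
      sym (genfun-stable n (s≤s n≤N) (≤-trans n≤N (≤-trans (m≤n*m N k) (m≤n*m (k * N) 3))))

  odd-count : ∀ l → let N = J₃.pos (suc l) in
    (∀ m → J.pos m ≢ N) → (∀ m → J.neg (suc m) ≢ N) →
    Σ ℕ (λ n → (l ≤ n) × (oddness n ≡ true))
  -- The recurrence involves only indices up to N, so a bounded search decides the matter and the
  -- argument by contradiction stays constructive.
  odd-count l ¬pos ¬neg with anyUpTo? (λ n → (l ≤? n) ×-dec (oddness n ≟ᵇ true)) (suc (J₃.pos (suc l)))
  ... | yes (n , _ , found) = n , found
  ... | no  none            = ⊥-elim (true≢false (trans (sym lhs) (trans (theta-recurrence N) rhs)))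
    where
    N : ℕ
    N = J₃.pos (suc l)
    true≢false : true ≢ false
    true≢false ()
    even : ∀ n → l ≤ n → n ≤ N → oddness n ≡ false
    even n l≤n n≤N = ¬-not (λ oddₙ → none (n , s≤s n≤N , l≤n , oddₙ))
    near : ∀ a → a + l ≤ N → shift a oddness N ≡ false
    near a a+l≤N = begin
      shift a oddness N            ≡⟨ cong (shift a oddness) (m+[n∸m]≡n a≤N) ⟨
      shift a oddness (a + (N ∸ a)) ≡⟨ shift-above a oddness (N ∸ a) ⟩
      oddness (N ∸ a)              ≡⟨ even (N ∸ a) (m+n≤o⇒m≤o∸n l (≤-trans (≤-reflexive (+-comm l a)) a+l≤N)) (m∸n≤m N a) ⟩
      false                        ∎
      where
      open ≡-Reasoning
      a≤N : a ≤ N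
      a≤N = ≤-trans (m≤m+n a l) a+l≤N
    lhs : J₃.theta oddness (k * N) N ≡ true
    lhs = cong₂ _xor_ (∑-false _ (k * N) (λ t _ → neg-term (suc t)))
            (∑-single (λ m → shift (J₃.pos m) oddness N) {suc l} (s≤s (≤-trans (J₃.n≤pos (suc l)) (m≤n*m N k)))
              at pos-term)
      where
      neg-term : ∀ t → shift (J₃.neg t) oddness N ≡ false
      neg-term t with <-≤-connex t (suc l)
      ... | inj₁ t<1+l = near (J₃.neg t) (neg-gap l t<1+l)
      ... | inj₂ 1+l≤t = shift-below (J₃.neg t) oddness N (neg-beyond l 1+l≤t)
      at : shift N oddness N ≡ true
      -- `oddness 0` computes to `true`: the empty overpartition is the only one.
      at = trans (cong (shift N oddness) (sym (+-identityʳ N))) (shift-above N oddness 0)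
      pos-term : ∀ m → m ≢ suc l → shift (J₃.pos m) oddness N ≡ false
      pos-term m m≢ with <-cmp m (suc l)
      ... | tri< m<1+l _ _ = near (J₃.pos m) (pos-gap l m<1+l)
      ... | tri≈ _ m≡ _    = ⊥-elim (m≢ m≡)
      ... | tri> _ _ 1+l<m = shift-below (J₃.pos m) oddness N (J₃.pos-< 1+l<m)
    rhs : J.theta δ (3 * N) N ≡ false
    rhs = cong₂ _xor_ (∑-false _ (3 * N) (λ t _ → shift-δ (J.neg (suc t)) N (¬neg t)))
                      (∑-false _ (suc (3 * N)) (λ m _ → shift-δ (J.pos m) N (¬pos m)))

-- Arithmetic modulo 3

data Residue₃ (n : ℕ) : Set where
  res0 : n % 3 ≡ 0 → Residue₃ n
  res1 : n % 3 ≡ 1 → Residue₃ n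
  res2 : n % 3 ≡ 2 → Residue₃ n

residue₃ : ∀ n → Residue₃ n
residue₃ n = from (n % 3) (m%n<n n 3) refl
  where
  from : ∀ r → r < 3 → n % 3 ≡ r → Residue₃ n
  from 0 _ e = res0 e
  from 1 _ e = res1 e
  from 2 _ e = res2 e
  from (suc (suc (suc r))) (s≤s (s≤s (s≤s ()))) e

+-%3 : ∀ a b {r s} → a % 3 ≡ r → b % 3 ≡ s → (a + b) % 3 ≡ (r + s) % 3
+-%3 a b refl refl = %-distribˡ-+ a b 3

*-%3 : ∀ a b {r s} → a % 3 ≡ r → b % 3 ≡ s → (a * b) % 3 ≡ (r * s) % 3
*-%3 a b refl refl = %-distribˡ-* a b 3

-- Put p = 2 + t. Modulo 3 the form is 2m² if p ≡ 2, and m (m - 1) or m (m + 1) if p ≡ 1; each takes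
-- only the values 0 and 2. For p ≡ 0 it would be ±m, which does reach 1.
no-solution-mod-3 : ∀ v t m → v % 3 ≡ 1 → t % 3 ≢ 1 →
  v ≢ (2 + t) * (m * m) + m * t × v + m * t ≢ (2 + t) * (m * m)
no-solution-mod-3 v t m v≡1 t≢1 = (λ eq → refute₊ (cong (_% 3) eq)) , (λ eq → refute₋ (cong (_% 3) eq))
  where
  square : ∀ {r s} → t % 3 ≡ r → m % 3 ≡ s →
    ((2 + t) * (m * m)) % 3 ≡ (((2 + r) % 3) * ((s * s) % 3)) % 3
  square tr ms = *-%3 (2 + t) (m * m) (+-%3 2 t refl tr) (*-%3 m m ms ms)
  linear : ∀ {r s} → t % 3 ≡ r → m % 3 ≡ s → (m * t) % 3 ≡ (s * r) % 3
  linear tr ms = *-%3 m t ms tr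
  sum : ∀ {r s} → t % 3 ≡ r → m % 3 ≡ s → _
  sum tr ms = +-%3 ((2 + t) * (m * m)) (m * t) (square tr ms) (linear tr ms)
  refute₊ : v % 3 ≢ ((2 + t) * (m * m) + m * t) % 3
  refute₊ eq with residue₃ t | residue₃ m
  ... | res1 tr | _       = t≢1 tr
  ... | res0 tr | res0 ms with () ← trans (sym v≡1) (trans eq (sum tr ms))
  ... | res0 tr | res1 ms with () ← trans (sym v≡1) (trans eq (sum tr ms))
  ... | res0 tr | res2 ms with () ← trans (sym v≡1) (trans eq (sum tr ms))
  ... | res2 tr | res0 ms with () ← trans (sym v≡1) (trans eq (sum tr ms))
  ... | res2 tr | res1 ms with () ← trans (sym v≡1) (trans eq (sum tr ms))
  ... | res2 tr | res2 ms with () ← trans (sym v≡1) (trans eq (sum tr ms))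
  refute₋ : (v + m * t) % 3 ≢ ((2 + t) * (m * m)) % 3
  refute₋ eq with residue₃ t | residue₃ m
  ... | res1 tr | _       = t≢1 tr
  ... | res0 tr | res0 ms with () ← trans (sym (+-%3 v _ v≡1 (linear tr ms))) (trans eq (square tr ms))
  ... | res0 tr | res1 ms with () ← trans (sym (+-%3 v _ v≡1 (linear tr ms))) (trans eq (square tr ms))
  ... | res0 tr | res2 ms with () ← trans (sym (+-%3 v _ v≡1 (linear tr ms))) (trans eq (square tr ms))
  ... | res2 tr | res0 ms with () ← trans (sym (+-%3 v _ v≡1 (linear tr ms))) (trans eq (square tr ms))
  ... | res2 tr | res1 ms with () ← trans (sym (+-%3 v _ v≡1 (linear tr ms))) (trans eq (square tr ms))
  ... | res2 tr | res2 ms with () ← trans (sym (+-%3 v _ v≡1 (linear tr ms))) (trans eq (square tr ms))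

ℓ[3ℓ∸1]≡2pos : ∀ ℓ → ℓ * (3 * ℓ ∸ 1) ≡ 2 * J₃.pos ℓ
ℓ[3ℓ∸1]≡2pos ℓ = begin
  ℓ * (3 * ℓ ∸ 1)          ≡⟨ *-distribˡ-∸ ℓ (3 * ℓ) 1 ⟩
  ℓ * (3 * ℓ) ∸ ℓ * 1      ≡⟨ cong (_∸ ℓ * 1) (x∙yz≈y∙xz *-commutativeSemigroup ℓ 3 ℓ) ⟩
  3 * (ℓ * ℓ) ∸ ℓ * 1      ≡⟨ J₃.2*pos-∸ ℓ ⟨
  2 * J₃.pos ℓ             ∎
  where
  open ≡-Reasoning

ℓ[3ℓ∸1]%3 : ∀ ℓ → ℓ % 3 ≡ 2 → (ℓ * (3 * ℓ ∸ 1)) % 3 ≡ 1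
ℓ[3ℓ∸1]%3 (suc ℓ) ℓ≡2 = trans (cong (λ z → (suc ℓ * z) % 3) (cong (_∸ 1) (*-suc 3 ℓ)))
  (*-%3 (suc ℓ) (2 + 3 * ℓ) ℓ≡2 (+-%3 2 (3 * ℓ) refl (trans (cong (_% 3) (*-comm 3 ℓ)) (m*n%n≡0 ℓ 3))))

prime⇒%3≢0 : ∀ {p} → Prime p → 5 ≤ p → p % 3 ≢ 0
prime⇒%3≢0 {p} p-prime 5≤p p≡0 with prime⇒irreducible p-prime (m%n≡0⇒n∣m p 3 p≡0)
... | inj₂ refl = ⊥-elim (<-irrefl refl (≤-trans (s≤s (s≤s (s≤s (s≤s z≤n)))) 5≤p))

-- The index m = 0 is included because the constant term of the theta series must miss the
-- pentagonal number too.
not-represented : ∀ {p} → Prime p → 5 ≤ p → ∀ ℓ → ℓ % 3 ≡ 2 → ∀ m →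
  (ℓ * (3 * ℓ ∸ 1) ≢ p * (m * m) + m * (p ∸ 2)) × (ℓ * (3 * ℓ ∸ 1) ≢ p * (m * m) ∸ m * (p ∸ 2))
not-represented {suc (suc t)} p-prime 5≤p ℓ ℓ≡2 m = ¬plus , λ v≡ → ¬minus (restore v≡1 v≡)
  where
  v≡1 : (ℓ * (3 * ℓ ∸ 1)) % 3 ≡ 1
  v≡1 = ℓ[3ℓ∸1]%3 ℓ ℓ≡2
  t≢1 : t % 3 ≢ 1
  t≢1 t≡1 = prime⇒%3≢0 p-prime 5≤p (+-%3 2 t refl t≡1)
  ¬plus  = proj₁ (no-solution-mod-3 (ℓ * (3 * ℓ ∸ 1)) t m v≡1 t≢1)
  ¬minus = proj₂ (no-solution-mod-3 (ℓ * (3 * ℓ ∸ 1)) t m v≡1 t≢1)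
  -- A truncated difference would be 0, which is not 1 modulo 3; hence the subtraction is genuine
  -- and can be undone.
  restore : ∀ {v a b} → v % 3 ≡ 1 → v ≡ a ∸ b → v + b ≡ a
  restore {a = a} {b} v≡1 refl with ≤-total b a
  ... | inj₁ b≤a = m∸n+n≡m b≤a
  ... | inj₂ a≤b with () ← trans (sym v≡1) (cong (_% 3) (m≤n⇒m∸n≡0 a≤b))

theorem1p3 : (p : ℕ) → Prime p → 5 ≤ p →
    ((ℓ : ℕ) → 2 ≤ ℓ → ℓ % 3 ≡ 2 → (m : ℕ) → 1 ≤ m →
    (ℓ * (3 * ℓ ∸ 1) ≢ p * (m * m) + m * (p ∸ 2))
    × (ℓ * (3 * ℓ ∸ 1) ≢ p * (m * m) ∸ m * (p ∸ 2)))
    × ((N : ℕ) → Σ ℕ (λ n → (N ≤ n) × (Cbar p 1 n % 2 ≡ 1)))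
theorem1p3 (suc (suc zero)) _ (s≤s (s≤s ()))
theorem1p3 (suc (suc (suc e))) p-prime 5≤p =
  (λ ℓ _ ℓ≡2 m _ → not-represented p-prime 5≤p ℓ ℓ≡2 m) , infinite
  where
  module J = Jacobi (suc e)
  infinite : ∀ N → Σ ℕ (λ n → (N ≤ n) × (Cbar (3 + e) 1 n % 2 ≡ 1))
  -- `odd-count` is indexed by ℓ - 1. The choice ℓ = 2 + 3N has residue 2, and ℓ - 1 = 1 + 3N is at
  -- least N.
  infinite N with Parity.odd-count e (1 + N * 3) ¬pos ¬neg
    where
    ℓ : ℕ
    ℓ = 2 + N * 3
    ℓ≡2 : ℓ % 3 ≡ 2
    ℓ≡2 = +-%3 2 (N * 3) refl (m*n%n≡0 N 3)
    ¬pos : ∀ m → J.pos m ≢ J₃.pos ℓ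
    ¬pos m eq = proj₂ (not-represented p-prime 5≤p ℓ ℓ≡2 m)
      (trans (ℓ[3ℓ∸1]≡2pos ℓ) (trans (cong (2 *_) (sym eq)) (J.2*pos-∸ m)))
    ¬neg : ∀ m → J.neg (suc m) ≢ J₃.pos ℓ
    ¬neg m eq = proj₁ (not-represented p-prime 5≤p ℓ ℓ≡2 (suc m))
      (trans (ℓ[3ℓ∸1]≡2pos ℓ) (trans (cong (2 *_) (sym eq)) (J.2*neg (suc m))))
  ... | n , l≤n , oddₙ = n , ≤-trans (≤-trans (m≤m*n N 3) (n≤1+n _)) l≤n , odd⇒%2 (Cbar (3 + e) 1 n) oddₙ
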